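{- For integers $m\geq 2$, let $q_m(n)=0$ if $p^m\mid n$ for some prime $p$, and $q_m(n)=1$ otherwise. Then for every $m\geq 2$ and every $k\geq 2$ the sequence $(q_m(n))_{n\geq 1}$ is not $k$-automatic; hence for each $m\geq 2$ the series $\sum_{n\geq 1}q_m(n)X^n$ is transcendental over $\mathbb{F}_p(X)$ for every prime $p$ and over $\mathbb{Z}(X)$.
   Context: A sequence $(t(n))_{n\geq 1}$ taking values in a finite set is $k$-automatic (for an integer $k\geq 2$) if its $k$-kernel $\{(t(k^l n+r))_{n}: l\geq 0,\ 0\leq r<k^l\}$ is finite. -}

module Defs where

open import Data.Nat as ℕ using (ℕ; zero; suc; _^_; _<_; _≤_; _∸_)
open import Data.Nat.Divisibility using (_∣?_)
open import Data.Nat.Primality using (Prime; prime?)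
open import Data.Fin using (Fin; toℕ)
open import Data.Fin.Properties using (any?)
open import Data.Integer as ℤ using (ℤ; +_)
open import Data.Integer.Divisibility as ℤd using ()
open import Data.List using (List; []; _∷_)
open import Data.List.Relation.Unary.Any using (Any)
open import Data.Product using (Σ; ∃; _×_)
open import Relation.Nullary using (¬_; yes; no)
open import Relation.Nullary.Decidable using (_×-dec_)
open import Relation.Binary.PropositionalEquality using (_≡_; _≢_)

-- q_m(n) = 0 if p^m ∣ n for some prime p, and 1 otherwise.
-- For n ≥ 1 any such prime satisfies p ≤ n, so the search over
-- p ∈ {0,…,n} decides "∃ prime p, p ^ m ∣ n".

q : ℕ → ℕ → ℕ
q m n with any? {n = suc n} (λ (i : Fin (suc n)) → prime? (toℕ i) ×-dec ((toℕ i ^ m) ∣? n))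
... | yes _ = 0
... | no  _ = 1

-- k-automatic sequences (t(n))_{n ≥ 1}: the k-kernel
-- { n ↦ t(k^l n + r) : l ≥ 0, 0 ≤ r < k^l } is finite, i.e. contained
-- in a finite family S₀,…,S_{N-1} of sequences (equality of sequences
-- indexed by n ≥ 1 being pointwise equality for n ≥ 1).

Automatic : ℕ → (ℕ → ℕ) → Set
Automatic k t =
  Σ ℕ λ N → Σ (Fin N → ℕ → ℕ) λ S →
    ∀ (l r : ℕ) → r < k ^ l →
      ∃ λ (i : Fin N) → ∀ (n : ℕ) → 1 ≤ n → t (k ^ l ℕ.* n ℕ.+ r) ≡ S i n

-- Formal power series with integer coefficients, as ℕ → ℤ.

sumUpTo : (ℕ → ℤ) → ℕ → ℤ
sumUpTo h zero    = h 0
sumUpTo h (suc n) = sumUpTo h n ℤ.+ h (suc n)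

conv : (ℕ → ℤ) → (ℕ → ℤ) → ℕ → ℤ
conv f g n = sumUpTo (λ i → f i ℤ.* g (n ∸ i)) n

one : ℕ → ℤ
one zero    = + 1
one (suc _) = + 0

spow : (ℕ → ℤ) → ℕ → ℕ → ℤ
spow f zero    = one
spow f (suc j) = conv f (spow f j)

coeffList : List ℤ → ℕ → ℤ
coeffList []       _       = + 0
coeffList (c ∷ cs) zero    = c
coeffList (c ∷ cs) (suc n) = coeffList cs n

-- A bivariate polynomial P(X,Y) = Σ_j A_j(X) Y^j is a list [A_0, A_1, …]
-- of coefficient lists.  evalFrom j P f = Σ_i A_i(X) f^(j+i).
evalFrom : ℕ → List (List ℤ) → (ℕ → ℤ) → ℕ → ℤ
evalFrom j []      f n = + 0
evalFrom j (A ∷ P) f n = conv (coeffList A) (spow f j) n ℤ.+ evalFrom (suc j) P f n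

evalPoly : List (List ℤ) → (ℕ → ℤ) → ℕ → ℤ
evalPoly = evalFrom 0

-- f is algebraic over F_p(X): some P ∈ F_p[X][Y] (coefficients taken as
-- integer lifts) that is nonzero mod p satisfies P(X,f) ≡ 0 mod p.
AlgebraicModP : ℕ → (ℕ → ℤ) → Set
AlgebraicModP p f =
  Σ (List (List ℤ)) λ P →
    Any (Any (λ c → ¬ ((+ p) ℤd.∣ c))) P × (∀ n → (+ p) ℤd.∣ evalPoly P f n)

-- f is algebraic over ℤ(X) (= ℚ(X)): some nonzero P ∈ ℤ[X][Y] has P(X,f) = 0.
AlgebraicZ : (ℕ → ℤ) → Set
AlgebraicZ f =
  Σ (List (List ℤ)) λ P →
    Any (Any (λ c → c ≢ + 0)) P × (∀ n → evalPoly P f n ≡ + 0)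

qSeries : ℕ → ℕ → ℤ
qSeries m zero    = + 0
qSeries m (suc n) = + q m (suc n)

{-# OPTIONS --safe #-}

-- By the Chinese remainder theorem one can find a window of consecutive integers in which
-- all but one are divisible by the m-th power of a large prime; the remaining one can
-- moreover be taken squarefree in a prescribed progression, because the squares ℓ² with
-- ℓ ≥ 2 remove less than a proportion 1 of a progression c + M t with c coprime to M.
--
-- Non-automaticity: a finite k-kernel would contain two equal subsequences with different
-- residues, and the window separates them.
--
-- Transcendence over F_p(X): if f is algebraic of degree d, all its powers lie, up to a
-- polynomial factor, in a module with d generators, so f, f^p, …, f^(p^d) satisfy a
-- nontrivial relation Σ cᵢ f^(p^i) = 0.  Since f^(p^i) = f(X^(p^i)), such a relation only
-- sees the coefficients of f in a short window, and a window with a single nonzero term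
-- forces each cᵢ to vanish in turn.  Over ℤ(X), reduce modulo a large prime.
module Submission where

-- One isolation lemma serves both halves, and its parameters record what each half needs. In a
-- relation Σ cᵢ f(X^(p^i)) = 0 the coefficient c_s is tested at an exponent p^s u: the terms with i
-- < s are already zero, and those with i > s vanish there as soon as p does not divide u. Hence the
-- survivor has the form K u with u in a prescribed class, and the killing primes avoid the modulus
-- of that class, so that a factor P^m of p^i v passes to v. For automaticity K is 1 and the class
-- is a residue modulo a power of k.
--
-- Each kill moves the survivor, so squarefreeness has to be arranged last, and room for it must
-- remain: the sieve keeps u coprime to the accumulated modulus, as the count of squarefree terms
-- requires.
--
-- Asking for squarefree survivors gives one argument for all m, and Σ 1/ℓ² is bounded by
-- telescoping, without estimates on primes.
--
-- The linear algebra runs over polynomials instead of F_p(X): elimination by cross-multiplication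
-- needs only an integral domain and a zero test, which polynomials have and arbitrary series do
-- not.

open import Defs
open import Algebra.Bundles using (CommutativeRing)
open import Data.Nat as ℕ using (ℕ; zero; suc; _≤_; s≤s; z≤n; z<s; s<s; _!)
import Data.Nat.Properties as ℕ
open import Data.Nat.Combinatorics using (_C_; nCn≡1; nCk≡nC[n∸k]; k![n∸k]!∣n!)
open import Data.Nat.Combinatorics.Specification using (nCk≡n!/k![n-k]!)
open import Data.Nat.Coprimality as Coprimality using (Coprime; coprime-Bézout; coprime-divisor)
open import Data.Nat.Divisibility as ℕ∣ using (_∣_; _∣?_; divides; _∣0)
open import Data.Nat.DivMod using (m/n*n≡m)
open import Data.Nat.GCD using (module Bézout)
open import Data.Nat.Primality using (Prime; prime?; euclidsLemma; prime⇒nonZero; prime⇒nonTrivial; prime⇒irreducible)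
open import Data.Nat.Primality.Factorisation using (factorise)
open import Data.Integer as ℤ using (ℤ)
import Data.Integer.Properties as ℤ
import Data.Integer.Divisibility as ℤ∣
import Data.Integer.Divisibility.Signed as ℤ∣ₛ
import Data.Integer.Tactic.RingSolver as ℤ-Solver
open import Data.Bool using (if_then_else_)
open import Data.Fin as Fin using (Fin; zero; suc; toℕ; fromℕ; fromℕ<; inject₁; punchIn)
import Data.Fin.Properties as Fin
open import Data.List using (List; []; _∷_; length; map)
open import Data.List.Relation.Unary.All using (All; []; _∷_)
open import Data.List.Relation.Unary.Any using (Any; here; there)
open import Data.Product using (∃; ∃₂; _×_; _,_; proj₁; proj₂)
open import Data.Sum using (inj₁; inj₂)
open import Data.Vec.Functional using (insertAt)
open import Data.Vec.Functional.Properties using (insertAt-lookup; insertAt-punchIn)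
open import Function using (_∘_)
open import Level using (Lift; lift; lower)
open import Relation.Binary using (tri<; tri≈; tri>)
open import Relation.Nullary using (¬_; Dec; yes; no; does; contradiction; ¬?)
open import Relation.Nullary.Decidable using (decidable-stable; map′; _×-dec_)
open import Relation.Binary.PropositionalEquality as ≡ using (_≡_; _≢_)
import Algebra.Properties.CommutativeSemigroup ℕ.+-commutativeSemigroup as ℕ+

-- Squarefree numbers in progressions

module Arithmetic where
  open import Data.Nat
  open import Data.Nat.Properties
  open import Data.Nat.DivMod
  open import Data.Nat.Divisibility
  open import Data.Nat.Tactic.RingSolver using (solve-∀)
  open import Relation.Binary.PropositionalEquality

  sum< : (ℕ → ℕ) → ℕ → ℕ
  sum< f zero    = 0
  sum< f (suc n) = f 0 + sum< (f ∘ suc) n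

  sum<-mono : ∀ {f g} n → (∀ i → f i ≤ g i) → sum< f n ≤ sum< g n
  sum<-mono zero    f≤g = z≤n
  sum<-mono (suc n) f≤g = +-mono-≤ (f≤g 0) (sum<-mono n (f≤g ∘ suc))

  sum<-monoʳ : ∀ f {m n} → m ≤ n → sum< f m ≤ sum< f n
  sum<-monoʳ f z≤n       = z≤n
  sum<-monoʳ f (s≤s m≤n) = +-monoʳ-≤ (f 0) (sum<-monoʳ (f ∘ suc) m≤n)

  sum<-zero : ∀ {f} n → (∀ i → i < n → f i ≡ 0) → sum< f n ≡ 0
  sum<-zero zero    f≡0 = refl
  sum<-zero (suc n) f≡0 = cong₂ _+_ (f≡0 0 z<s) (sum<-zero n λ i i<n → f≡0 (suc i) (s<s i<n))

  sum<-distrib-+ : ∀ f g n → sum< (λ i → f i + g i) n ≡ sum< f n + sum< g n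
  sum<-distrib-+ f g zero    = refl
  sum<-distrib-+ f g (suc n) = trans
    (cong (f 0 + g 0 +_) (sum<-distrib-+ (f ∘ suc) (g ∘ suc) n))
    (interchange (f 0) (g 0) (sum< (f ∘ suc) n) (sum< (g ∘ suc) n))
    where
    interchange : ∀ a b c d → a + b + (c + d) ≡ a + c + (b + d)
    interchange = solve-∀

  sum<-comm : ∀ (f : ℕ → ℕ → ℕ) a b →
    sum< (λ i → sum< (f i) b) a ≡ sum< (λ j → sum< (λ i → f i j) a) b
  sum<-comm f zero    b = sym (sum<-zero b λ _ _ → refl)
  sum<-comm f (suc a) b = trans
    (cong (sum< (f 0) b +_) (sum<-comm (f ∘ suc) a b))
    (sym (sum<-distrib-+ (f 0) (λ j → sum< (λ i → f (suc i) j) a) b))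

  sum<-++ : ∀ f a b → sum< f (a + b) ≡ sum< f a + sum< (λ i → f (a + i)) b
  sum<-++ f zero    b = refl
  sum<-++ f (suc a) b = trans (cong (f 0 +_) (sum<-++ (f ∘ suc) a b)) (sym (+-assoc (f 0) _ _))

  term≤sum< : ∀ f {i n} → i < n → f i ≤ sum< f n
  term≤sum< f {zero}  {suc n} _   = m≤m+n (f 0) _
  term≤sum< f {suc i} {suc n} i<n = ≤-trans (term≤sum< (f ∘ suc) (s<s⁻¹ i<n)) (m≤n+m _ (f 0))

  sum<⇒∃zero : ∀ f n → sum< f n < n → ∃ λ i → i < n × f i ≡ 0
  sum<⇒∃zero f (suc n) lt with f 0 in eq
  ... | zero  = 0 , z<s , eq
  ... | suc k =
    let i , i<n , fi≡0 = sum<⇒∃zero (f ∘ suc) n (<-≤-trans (s≤s (m≤n+m _ k)) (s≤s⁻¹ lt))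
    in suc i , s<s i<n , fi≡0

  indicator : ∀ {P : Set} → Dec P → ℕ
  indicator P? = if does P? then 1 else 0

  indicator-no : ∀ {P : Set} (P? : Dec P) → ¬ P → indicator P? ≡ 0
  indicator-no (yes p) ¬p = contradiction p ¬p
  indicator-no (no _)  _  = refl

  indicator≡0 : ∀ {P : Set} (P? : Dec P) → indicator P? ≡ 0 → ¬ P
  indicator≡0 (no ¬p) _ = ¬p

  count< : ∀ {P : ℕ → Set} → (∀ t → Dec (P t)) → ℕ → ℕ
  count< P? = sum< (λ t → indicator (P? t))

  Sparse : ℕ → (ℕ → Set) → Set
  Sparse d P = ∀ t e → P t → P (t + suc e) → d ≤ suc e

  count-window : ∀ {d P} (P? : ∀ t → Dec (P t)) → Sparse d P → ∀ n → n ≤ d → count< P? n ≤ 1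
  count-window P? sparse zero    n≤d = z≤n
  count-window P? sparse (suc n) n≤d with P? 0
  ... | no  _  = count-window (P? ∘ suc) (λ t → sparse (suc t)) n (<⇒≤ n≤d)
  ... | yes p₀ = s≤s (≤-reflexive (sum<-zero n λ i i<n →
    indicator-no (P? (suc i)) λ pᵢ → <⇒≱ (≤-trans (s≤s i<n) n≤d) (sparse 0 i p₀ pᵢ)))

  count-blocks : ∀ {d P} (P? : ∀ t → Dec (P t)) → Sparse d P → ∀ s → count< P? (s * d) ≤ s
  count-blocks P? sparse zero    = z≤n
  count-blocks {d} {P} P? sparse (suc s) = begin
    count< P? (d + s * d)                          ≡⟨ sum<-++ _ d (s * d) ⟩
    count< P? d + count< (λ t → P? (d + t)) (s * d) ≤⟨ +-mono-≤ (count-window P? sparse d ≤-refl)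
        (count-blocks (λ t → P? (d + t)) shifted s) ⟩
    suc s                                          ∎
    where
    open ≤-Reasoning
    shifted : Sparse d (λ t → P (d + t))
    shifted t e p q = sparse (d + t) e p (subst P (sym (+-assoc d t (suc e))) q)

  -- A window of length `d` holds at most one hit, and `T / d + 1` windows cover the first `T`
  -- terms.
  count-sparse : ∀ {d P} .{{_ : NonZero d}} (P? : ∀ t → Dec (P t)) → Sparse d P →
    ∀ T → count< P? T ≤ suc (T / d)
  count-sparse {d} P? sparse T =
    ≤-trans (sum<-monoʳ _ T≤) (count-blocks P? sparse (suc (T / d)))
    where
    T≤ : T ≤ suc (T / d) * d
    T≤ = begin
      T                   ≡⟨ m≡m%n+[m/n]*n T d ⟩
      T % d + T / d * d   ≤⟨ +-monoˡ-≤ _ (m%n≤n T d) ⟩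
      d + T / d * d       ∎
      where open ≤-Reasoning

  SquareFree : ℕ → Set
  SquareFree n = ∀ d → 2 ≤ d → ¬ (d * d ∣ n)

  -- Floor version of 1/(ℓ+1)² ≤ 1/ℓ - 1/(ℓ+1), arranged as a sum to stay clear of truncated
  -- subtraction.
  square-telescope : ∀ T ℓ .{{_ : NonZero ℓ}} →
    T / (suc ℓ * suc ℓ) + T / suc ℓ ≤ T / ℓ
  square-telescope T ℓ = begin
    a + b             ≡⟨ sym (m*n/n≡m (a + b) ℓ) ⟩
    (a + b) * ℓ / ℓ   ≤⟨ /-monoˡ-≤ ℓ [a+b]ℓ≤T ⟩
    T / ℓ             ∎
    where
    open ≤-Reasoning
    a b : ℕ
    a = T / (suc ℓ * suc ℓ)
    b = T / suc ℓ
    expand : ∀ a b ℓ → suc ℓ * ((a + b) * ℓ) + a * suc ℓ ≡ a * (suc ℓ * suc ℓ) + ℓ * (b * suc ℓ)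
    expand = solve-∀
    [a+b]ℓ≤T : (a + b) * ℓ ≤ T
    [a+b]ℓ≤T = *-cancelˡ-≤ (suc ℓ) (begin
      suc ℓ * ((a + b) * ℓ)                 ≤⟨ m≤m+n _ _ ⟩
      suc ℓ * ((a + b) * ℓ) + a * suc ℓ     ≡⟨ expand a b ℓ ⟩
      a * (suc ℓ * suc ℓ) + ℓ * (b * suc ℓ) ≤⟨ +-mono-≤ (m/n*n≤m T (suc ℓ * suc ℓ)) (*-monoʳ-≤ ℓ (m/n*n≤m T (suc ℓ))) ⟩
      T + ℓ * T                             ∎)

  -- The inequalities of `square-telescope` chain together. Starting at 3² matters: telescoping from
  -- 2² would only give the useless bound `T`, whereas counting the multiples of 4 separately leaves
  -- T/4 + T/2 < T.
  sum-inverse-squares : ∀ T n → sum< (λ j → suc (T / ((3 + j) * (3 + j)))) n ≤ n + T / 2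
  sum-inverse-squares T n = ≤-trans (m≤m+n _ (T / (2 + n))) (go 1 n)
    where
    open ≤-Reasoning
    rearrange : ∀ a b c → suc a + b + c ≡ suc a + (b + c)
    rearrange = solve-∀
    rearrange′ : ∀ a b n → suc a + (n + b) ≡ suc n + (a + b)
    rearrange′ = solve-∀
    go : ∀ ℓ n → sum< (λ j → suc (T / ((2 + ℓ + j) * (2 + ℓ + j)))) n + T / (1 + ℓ + n) ≤ n + T / (1 + ℓ)
    go ℓ zero = ≤-reflexive (cong (λ k → T / suc k) (+-identityʳ ℓ))
    go ℓ (suc n) = begin
      suc (T / ((2 + ℓ + 0) * (2 + ℓ + 0))) + sum< (λ j → suc (T / ((2 + ℓ + suc j) * (2 + ℓ + suc j)))) n + T / (1 + ℓ + suc n)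
        ≡⟨ rearrange (T / ((2 + ℓ + 0) * (2 + ℓ + 0))) _ _ ⟩
      suc (T / ((2 + ℓ + 0) * (2 + ℓ + 0))) + (sum< (λ j → suc (T / ((2 + ℓ + suc j) * (2 + ℓ + suc j)))) n + T / (1 + ℓ + suc n))
        ≡⟨ cong₂ (λ k z → suc (T / ((2 + k) * (2 + k))) + z) (+-identityʳ ℓ)
             (cong₂ _+_ (sum<-cong n (λ j → cong (λ k → suc (T / ((2 + k) * (2 + k)))) (+-suc ℓ j)))
               (cong (λ k → T / suc k) (+-suc ℓ n))) ⟩
      suc (T / ((2 + ℓ) * (2 + ℓ))) + (sum< (λ j → suc (T / ((3 + ℓ + j) * (3 + ℓ + j)))) n + T / (2 + ℓ + n))
        ≤⟨ +-monoʳ-≤ (suc (T / ((2 + ℓ) * (2 + ℓ)))) (go (suc ℓ) n) ⟩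
      suc (T / ((2 + ℓ) * (2 + ℓ))) + (n + T / (2 + ℓ))
        ≡⟨ rearrange′ (T / ((2 + ℓ) * (2 + ℓ))) _ n ⟩
      suc n + (T / ((2 + ℓ) * (2 + ℓ)) + T / (2 + ℓ))
        ≤⟨ +-monoʳ-≤ (suc n) (square-telescope T (suc ℓ)) ⟩
      suc n + T / (1 + ℓ) ∎
      where
      sum<-cong : ∀ {f g} n → (∀ i → f i ≡ g i) → sum< f n ≡ sum< g n
      sum<-cong zero    eq = refl
      sum<-cong (suc n) eq = cong₂ _+_ (eq 0) (sum<-cong n (eq ∘ suc))

  coprime-progression : ∀ {c M d t} → Coprime c M → d ∣ c + M * t → Coprime d M
  coprime-progression {c} {M} {d} {t} c⊥M d∣ {e} (e∣d , e∣M) =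
    c⊥M (∣m+n∣m⇒∣n (subst (e ∣_) (+-comm c (M * t)) (∣-trans e∣d d∣)) (∣m⇒∣m*n t e∣M) , e∣M)

  -- Two hits differ by `M * suc e`, and `M` can be cancelled: a hit already forces `d` to be
  -- coprime to `M`, since a common divisor would divide `c`. Thus every `d` is covered, also one
  -- sharing factors with `M`, which is never hit unless the common factor is trivial.
  progression-sparse : ∀ {c M} d → Coprime c M → Sparse d (λ t → d ∣ c + M * t)
  progression-sparse {c} {M} d c⊥M t e d∣ d∣′ = ∣⇒≤ (coprime-divisor (coprime-progression {t = t} c⊥M d∣)
    (∣m+n∣m⇒∣n (subst (d ∣_) (split c M t e) d∣′) d∣))
    where
    split : ∀ c M t e → c + M * (t + suc e) ≡ (c + M * t) + M * suc e
    split = solve-∀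

  -- Among the first T = 4S terms, at most T/4 + 1 are divisible by 4, and at most
  -- Σ_{3 ≤ ℓ < S} (T/ℓ² + 1) ≤ T/2 + S − 3 by a larger square ℓ² < S²; this leaves a
  -- squarefree term since all terms are below S².
  squareFree-in-progression : ∀ c M → 1 ≤ c → Coprime c M → ∃ λ t → SquareFree (c + M * t)
  squareFree-in-progression c M 1≤c c⊥M =
    let t , t<T , none = sum<⇒∃zero bad T bad<T in t , squareFree t t<T none
    where
    N S T : ℕ
    -- Chosen so that S² = S·c + 4·M·S + 3·S exceeds c + M·t for every t < 4·S: no square of a
    -- number ≥ S can divide a term.
    N = c + 4 * M
    S = 3 + N
    T = S * 4
    divides? : ∀ j t → Dec ((2 + j) * (2 + j) ∣ c + M * t)
    divides? j t = (2 + j) * (2 + j) ∣? c + M * t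
    bad : ℕ → ℕ
    bad t = sum< (λ j → indicator (divides? j t)) (suc N)

    bad<T : sum< bad T < T
    bad<T = begin-strict
      sum< bad T
        ≡⟨ sum<-comm (λ t j → indicator (divides? j t)) T (suc N) ⟩
      sum< (λ j → count< (divides? j) T) (suc N)
        ≤⟨ sum<-mono (suc N) (λ j → count-sparse (divides? j) (progression-sparse {c} {M} ((2 + j) * (2 + j)) c⊥M) T) ⟩
      suc (T / 4) + sum< (λ j → suc (T / ((3 + j) * (3 + j)))) N
        ≤⟨ +-monoʳ-≤ (suc (T / 4)) (sum-inverse-squares T N) ⟩
      suc (T / 4) + (N + T / 2)
        ≡⟨ cong₂ (λ x y → suc x + (N + y)) (m*n/n≡m S 4) (trans (cong (_/ 2) (sym (*-assoc S 2 2))) (m*n/n≡m (S * 2) 2)) ⟩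
      suc S + (N + S * 2)
        <⟨ ≤-trans (m≤m+n _ 1) (≤-reflexive (final N)) ⟩
      T ∎
      where
      open ≤-Reasoning
      final : ∀ N → suc (suc (3 + N) + (N + (3 + N) * 2)) + 1 ≡ (3 + N) * 4
      final = solve-∀

    term<S² : ∀ t → t < T → c + M * t < S * S
    term<S² t t<T = begin-strict
      c + M * t             ≤⟨ +-monoʳ-≤ c (*-monoʳ-≤ M (<⇒≤ t<T)) ⟩
      c + M * (S * 4)       <⟨ m<m+n _ {S * 3 + (2 + N) * c} z<s ⟩
      c + M * (S * 4) + (S * 3 + (2 + N) * c) ≡⟨ expand c M N ⟩
      S * (3 + (c + 4 * M)) ∎
      where
      open ≤-Reasoning
      expand : ∀ c M N → c + M * ((3 + N) * 4) + ((3 + N) * 3 + (2 + N) * c) ≡ (3 + N) * (3 + (c + 4 * M))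
      expand = solve-∀

    squareFree : ∀ t → t < T → bad t ≡ 0 → SquareFree (c + M * t)
    squareFree t t<T bad≡0 (suc (suc j)) _ d²∣ with j <? suc N
    ... | yes j<N = indicator≡0 (divides? j t)
      (n≤0⇒n≡0 (subst (indicator (divides? j t) ≤_) bad≡0 (term≤sum< (λ j → indicator (divides? j t)) j<N))) d²∣
    ... | no  j≮N = <⇒≱ (term<S² t t<T)
      (≤-trans (*-mono-≤ S≤d S≤d) (∣⇒≤ {{>-nonZero (≤-trans 1≤c (m≤m+n c _))}} d²∣))
      where
      S≤d : S ≤ 2 + j
      S≤d = s≤s (s≤s (≮⇒≥ j≮N))
    squareFree t t<T bad≡0 1 (s≤s ())

  -- Isolated squarefree numbers

  prime⇒2≤ : ∀ {p} → Prime p → 2 ≤ p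
  prime⇒2≤ prime[p] = nonTrivial⇒n>1 _ {{prime⇒nonTrivial prime[p]}}

  prime∤1 : ∀ {p} → Prime p → ¬ p ∣ 1
  prime∤1 prime[p] p∣1 = <⇒≱ (prime⇒2≤ prime[p]) (∣⇒≤ p∣1)

  n∣n! : ∀ n → 1 ≤ n → n ∣ n !
  n∣n! (suc n) _ = m∣m*n (n !)

  prime> : ∀ B → ∃ λ p → Prime p × B < p
  prime> B with factorise (suc (B !))
  ... | record { factors = [] ; isFactorisation = eq } =
    contradiction (suc-injective eq) (≢-nonZero⁻¹ (B !) {{B !≢0}})
  ... | record { factors = p ∷ ps ; isFactorisation = eq ; factorsPrime = prime[p] ∷ _ } =
    p , prime[p] , ≰⇒> λ p≤B → prime∤1 prime[p]
      (∣m+n∣m⇒∣n (subst (p ∣_) (trans (sym eq) (sym (+-comm (B !) 1))) (m∣m*n _))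
        (∣-trans (n∣n! p (<⇒≤ (prime⇒2≤ prime[p]))) (m≤n⇒m!∣n! p≤B)))

  prime∣^ : ∀ {p} → Prime p → ∀ m n → p ∣ m ^ n → p ∣ m
  prime∣^ prime[p] m zero    p∣1 = contradiction p∣1 (prime∤1 prime[p])
  prime∣^ prime[p] m (suc n) p∣  with euclidsLemma m (m ^ n) prime[p] p∣
  ... | inj₁ p∣m = p∣m
  ... | inj₂ p∣mⁿ = prime∣^ prime[p] m n p∣mⁿ

  ∤⇒coprime : ∀ {p n} → Prime p → ¬ p ∣ n → Coprime n p
  ∤⇒coprime prime[p] p∤n (d∣n , d∣p) with prime⇒irreducible prime[p] d∣p
  ... | inj₁ d≡1  = d≡1
  ... | inj₂ refl = contradiction d∣n p∤n

  coprime-* : ∀ {u a b} → Coprime u a → Coprime u b → Coprime u (a * b)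
  coprime-* u⊥a u⊥b {d} (d∣u , d∣ab) =
    u⊥b (d∣u , coprime-divisor (λ { (e∣d , e∣a) → u⊥a (∣-trans e∣d d∣u , e∣a) }) d∣ab)

  coprime-^ : ∀ {u p} k → Coprime u p → Coprime u (p ^ k)
  coprime-^ zero    u⊥p (_ , d∣1) = ∣1⇒≡1 d∣1
  coprime-^ (suc k) u⊥p = coprime-* u⊥p (coprime-^ k u⊥p)

  solve-congruence : ∀ a b c → .{{NonZero b}} → Coprime a b → ∃ λ t → b ∣ c + a * t
  solve-congruence a (suc b) c a⊥b with coprime-Bézout a⊥b
  -- The modulus is `suc b`, so `b` represents -1 and `x * (c * b)` is -c times the inverse `x` of
  -- `a`. In the other case -x is the inverse and the sign takes care of itself.
  ... | Bézout.+- x y eq = x * (c * b) , divides (c + y * (c * b)) (begin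
      c + a * (x * (c * b))          ≡⟨ assoc c a x b ⟩
      c + x * a * (c * b)            ≡⟨ cong (λ z → c + z * (c * b)) (sym eq) ⟩
      c + (1 + y * suc b) * (c * b)  ≡⟨ collect c y b ⟩
      (c + y * (c * b)) * suc b      ∎)
    where
    open ≡-Reasoning
    assoc : ∀ c a x b → c + a * (x * (c * b)) ≡ c + x * a * (c * b)
    assoc = solve-∀
    collect : ∀ c y b → c + (1 + y * suc b) * (c * b) ≡ (c + y * (c * b)) * suc b
    collect = solve-∀
  ... | Bézout.-+ x y eq = x * c , divides (c * y) (begin
      c + a * (x * c)   ≡⟨ factor c a x ⟩
      c * (1 + x * a)   ≡⟨ cong (c *_) eq ⟩
      c * (y * suc b)   ≡⟨ sym (*-assoc c y (suc b)) ⟩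
      c * y * suc b     ∎)
    where
    open ≡-Reasoning
    factor : ∀ c a x → c + a * (x * c) ≡ c * (1 + x * a)
    factor = solve-∀

  ∣shifts⇒∣distance : ∀ {P} n i j → P ∣ n + i → P ∣ n + j → P ∣ ∣ i - j ∣
  ∣shifts⇒∣distance n zero    zero    _ _ = _ ∣0
  ∣shifts⇒∣distance n zero    (suc j) P∣i P∣j = ∣m+n∣m⇒∣n P∣j (subst (_ ∣_) (+-identityʳ n) P∣i)
  ∣shifts⇒∣distance n (suc i) zero    P∣i P∣j = ∣m+n∣m⇒∣n P∣i (subst (_ ∣_) (+-identityʳ n) P∣j)
  ∣shifts⇒∣distance {P} n (suc i) (suc j) P∣i P∣j = ∣shifts⇒∣distance (suc n) i j
    (subst (P ∣_) (+-suc n i) P∣i) (subst (P ∣_) (+-suc n j) P∣j)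

  -- Killing one position n + i after the other by the Chinese remainder theorem, along the
  -- progressions u + M′ t and n + K M′ t, keeps the position n + i₀ = K u alive.
  module Isolation (m : ℕ) (1≤m : 1 ≤ m) (K M c D i₀ : ℕ)
    .{{_ : NonZero K}} .{{_ : NonZero M}} (c⊥M : Coprime c M) (i₀≤D : i₀ ≤ D) where

    -- Writing u = c + M t, a shift of u by M′ x shifts n by K M′ x. Since `M′` is divisible by
    -- every P ^ m used so far, such shifts undo no kill. `coprime` is kept for the final choice of
    -- a squarefree u, and `1≤t` makes u positive.
    record Sieved (j : ℕ) : Set where
      field
        t n M′     : ℕ
        1≤t        : 1 ≤ t
        M′≢0       : NonZero M′
        M∣M′       : M ∣ M′
        coprime    : Coprime (c + M * t) M′
        position   : n + i₀ ≡ K * (c + M * t)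
        killed     : ∀ i → i < j → i ≢ i₀ →
                     ∃ λ P → Prime P × ¬ P ∣ M × P ^ m ∣ n + i × P ^ m ∣ M′

    sieve-start : Sieved 0
    sieve-start = record
      -- This `t` makes K u at least `i₀`, so the subtraction defining `n` is not truncated.
      { t = suc i₀ ; n = K * (c + M * suc i₀) ∸ i₀ ; M′ = M ; 1≤t = s≤s z≤n ; M′≢0 = >-nonZero (>-nonZero⁻¹ M) ; M∣M′ = ∣-refl
      ; coprime = λ { (d∣u , d∣M) → coprime-progression {t = suc i₀} c⊥M d∣u (∣-refl , d∣M) }
      ; position = m∸n+n≡m (begin
          i₀                   ≤⟨ n≤1+n i₀ ⟩
          suc i₀               ≤⟨ m≤n*m (suc i₀) M ⟩
          M * suc i₀           ≤⟨ m≤n+m _ c ⟩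
          c + M * suc i₀       ≤⟨ m≤n*m _ K ⟩
          K * (c + M * suc i₀) ∎)
      ; killed = λ _ () }
      where
      open ≤-Reasoning

    record Advanced {j} (s : Sieved j) (x : ℕ) : Set where
      open Sieved s
      field
        next    : Sieved j
        next-n  : Sieved.n next ≡ n + K * M′ * x
        next-u  : c + M * Sieved.t next ≡ c + M * t + M′ * x

    advance : ∀ {j} (s : Sieved j) x → Advanced s x
    advance s x = record
      { next = record
        { t = t + e * x ; n = n + K * M′ * x ; M′ = M′
        ; 1≤t = ≤-trans 1≤t (m≤m+n t _) ; M′≢0 = M′≢0 ; M∣M′ = M∣M′
        ; coprime = subst (λ u → Coprime u M′) (sym u≡) λ { (d∣u , d∣M′) →
            coprime-progression {t = x} coprime d∣u (∣-refl , d∣M′) }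
        ; position = begin
            n + K * M′ * x + i₀                ≡⟨ swap n i₀ K M′ x ⟩
            n + i₀ + K * (M′ * x)              ≡⟨ cong (_+ K * (M′ * x)) position ⟩
            K * (c + M * t) + K * (M′ * x)     ≡⟨ sym (*-distribˡ-+ K _ _) ⟩
            K * (c + M * t + M′ * x)           ≡⟨ cong (K *_) (sym u≡) ⟩
            K * (c + M * (t + e * x))          ∎
        ; killed = λ i i<j i≢i₀ → let P , prime[P] , P∤M , Pᵐ∣n+i , Pᵐ∣M′ = killed i i<j i≢i₀ in
            P , prime[P] , P∤M ,
            subst (P ^ m ∣_) (sym (swap n i K M′ x)) (∣m∣n⇒∣m+n Pᵐ∣n+i (∣n⇒∣m*n K (∣m⇒∣m*n x Pᵐ∣M′))) ,
            Pᵐ∣M′ }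
      ; next-n = refl
      ; next-u = u≡ }
      where
      open Sieved s
      open ≡-Reasoning
      e = quotient M∣M′
      u≡ : c + M * (t + e * x) ≡ c + M * t + M′ * x
      u≡ = trans (lemma c M t e x) (cong (λ z → c + M * t + z * x) (sym (_∣_.equality M∣M′)))
        where
        lemma : ∀ c M t e x → c + M * (t + e * x) ≡ c + M * t + e * M * x
        lemma = solve-∀
      swap : ∀ n i K M′ x → n + K * M′ * x + i ≡ n + i + K * (M′ * x)
      swap = solve-∀

    -- A prime P > K M′ + D does two jobs. It does not divide K M′, so some shift makes P ^ m divide
    -- n + j. And it does not divide the new u: otherwise it would divide both n + j and n + i₀ = K
    -- u, hence their nonzero distance, which is at most D. So u stays coprime to M′ P ^ m.
    kill : ∀ {j} → j ≤ D → j ≢ i₀ → Sieved j → Sieved (suc j)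
    kill {j} j≤D j≢i₀ s = record
      { t = N.t ; n = N.n ; M′ = N.M′ * P ^ m ; 1≤t = N.1≤t
      ; M′≢0 = m*n≢0 N.M′ (P ^ m) {{N.M′≢0}}
      ; M∣M′ = ∣m⇒∣m*n (P ^ m) N.M∣M′
      ; coprime = coprime-* N.coprime (coprime-^ m (∤⇒coprime prime[P] P∤u))
      ; position = N.position
      ; killed = killed′ }
      where
      open Sieved s using (n; M′; M′≢0; M∣M′)
      instance
        _ : NonZero M′
        _ = M′≢0

      large-prime : ∃ λ P → Prime P × K * M′ + D < P
      large-prime = prime> (K * M′ + D)
      P = proj₁ large-prime
      prime[P] = proj₁ (proj₂ large-prime)
      P-large = proj₂ (proj₂ large-prime)

      instance
        P≢0 : NonZero P
        P≢0 = prime⇒nonZero prime[P]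
        Pᵐ≢0 : NonZero (P ^ m)
        Pᵐ≢0 = m^n≢0 P m
        KM′≢0 : NonZero (K * M′)
        KM′≢0 = m*n≢0 K M′

      P∤KM′ : ¬ P ∣ K * M′
      P∤KM′ P∣ = <⇒≱ P-large (≤-trans (∣⇒≤ P∣) (m≤m+n _ D))

      hit : ∃ λ x → P ^ m ∣ (n + j) + K * M′ * x
      hit = solve-congruence (K * M′) (P ^ m) (n + j) (coprime-^ m (∤⇒coprime prime[P] P∤KM′))
      x = proj₁ hit

      open Advanced (advance s x)
      module N = Sieved next

      Pᵐ∣n+j : P ^ m ∣ N.n + j
      Pᵐ∣n+j = subst (P ^ m ∣_) (trans (swap n j (K * M′ * x)) (cong (_+ j) (sym next-n))) (proj₂ hit)
        where
        swap : ∀ n j y → n + j + y ≡ n + y + j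
        swap = solve-∀

      P∣Pᵐ : ∀ k → 1 ≤ k → P ∣ P ^ k
      P∣Pᵐ (suc k) _ = m∣m*n (P ^ k)

      P∤u : ¬ P ∣ c + M * N.t
      P∤u P∣u = <⇒≱ P-large (begin
        P              ≤⟨ ∣⇒≤ {{≢-nonZero (j≢i₀ ∘ ∣m-n∣≡0⇒m≡n)}} (∣shifts⇒∣distance N.n j i₀
                            (∣-trans (P∣Pᵐ m 1≤m) Pᵐ∣n+j) (subst (P ∣_) (sym N.position) (∣n⇒∣m*n K P∣u))) ⟩
        ∣ j - i₀ ∣     ≤⟨ ∣m-n∣≤m⊔n j i₀ ⟩
        j ⊔ i₀         ≤⟨ ⊔-lub j≤D i₀≤D ⟩
        D              ≤⟨ m≤n+m D _ ⟩
        K * M′ + D     ∎)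
        where open ≤-Reasoning

      killed′ : ∀ i → i < suc j → i ≢ i₀ →
                ∃ λ P′ → Prime P′ × ¬ P′ ∣ M × P′ ^ m ∣ N.n + i × P′ ^ m ∣ N.M′ * P ^ m
      killed′ i i<1+j i≢i₀ with m≤n⇒m<n∨m≡n (s≤s⁻¹ i<1+j)
      ... | inj₁ i<j  = let P′ , prime[P′] , P′∤M , ∣n+i , ∣M′ = N.killed i i<j i≢i₀ in
        P′ , prime[P′] , P′∤M , ∣n+i , ∣m⇒∣m*n (P ^ m) ∣M′
      ... | inj₂ refl =
        P , prime[P] , (λ P∣M → P∤KM′ (∣n⇒∣m*n K (∣-trans P∣M M∣M′))) , Pᵐ∣n+j , n∣m*n N.M′

    sieve : ∀ j → j ≤ suc D → Sieved j
    sieve zero    _     = sieve-start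
    sieve (suc j) j≤D with j ≟ i₀ | sieve j (<⇒≤ j≤D)
    ... | no j≢i₀  | s = kill (s≤s⁻¹ j≤D) j≢i₀ s
    ... | yes refl | s = record
      { t = t ; n = n ; M′ = M′ ; 1≤t = 1≤t ; M′≢0 = M′≢0 ; M∣M′ = M∣M′
      ; coprime = coprime ; position = position
      ; killed = λ i i<1+j i≢i₀ → killed i (≤∧≢⇒< (s≤s⁻¹ i<1+j) i≢i₀) i≢i₀ }
      where open Sieved s

    abstract
      -- After the sieve, the values of u still reachable form the progression u + M′ x with u
      -- coprime to M′. It contains a squarefree term, and moving there leaves all kills in place.
      isolate : ∃₂ λ t n → 1 ≤ t × n + i₀ ≡ K * (c + M * t) × SquareFree (c + M * t) ×
        (∀ i → i ≤ D → i ≢ i₀ → ∃ λ P → Prime P × ¬ P ∣ M × P ^ m ∣ n + i)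
      isolate = F.t , F.n , F.1≤t , F.position , subst SquareFree (sym next-u) (proj₂ free) ,
        λ i i≤D i≢i₀ → let P , prime[P] , P∤M , ∣n+i , _ = F.killed i (s≤s i≤D) i≢i₀ in
          P , prime[P] , P∤M , ∣n+i
        where
        s : Sieved (suc D)
        s = sieve (suc D) ≤-refl
        open Sieved s
        1≤u : 1 ≤ c + M * t
        1≤u = ≤-trans (≤-trans 1≤t (m≤n*m t M)) (m≤n+m _ c)
        free : ∃ λ x → SquareFree (c + M * t + M′ * x)
        free = squareFree-in-progression (c + M * t) M′ 1≤u coprime
        open Advanced (advance s (proj₁ free))
        module F = Sieved next

  -- The sequence q and its kernels

  n<k^n : ∀ {k} n → 2 ≤ k → n < k ^ n
  n<k^n     zero    _   = z<s
  n<k^n {k} (suc n) 2≤k = begin-strict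
    suc n           ≤⟨ n<k^n n 2≤k ⟩
    k ^ n           <⟨ m<m*n (k ^ n) k 2≤k ⟩
    k ^ n * k       ≡⟨ *-comm (k ^ n) k ⟩
    k * k ^ n       ∎
    where
    open ≤-Reasoning
    instance
      _ : NonZero (k ^ n)
      _ = m^n≢0 k n {{>-nonZero (<⇒≤ 2≤k)}}

  q≡0 : ∀ {m P n} → 1 ≤ m → Prime P → 1 ≤ n → P ^ m ∣ n → q m n ≡ 0
  q≡0 {suc m} {P} {n} _ prime[P] 1≤n Pᵐ∣n
    with Fin.any? {n = suc n} (λ i → prime? (toℕ i) ×-dec ((toℕ i ^ suc m) ∣? n))
  ... | yes _  = refl
  ... | no  ∄P = contradiction
    (fromℕ< P<1+n , subst (λ p → Prime p × p ^ suc m ∣ n) (sym (Fin.toℕ-fromℕ< P<1+n)) (prime[P] , Pᵐ∣n)) ∄P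
    where
    P<1+n : P < suc n
    P<1+n = s≤s (∣⇒≤ {{>-nonZero 1≤n}} (∣-trans (m∣m*n (P ^ m)) Pᵐ∣n))

  q≡1 : ∀ {m n} → 2 ≤ m → SquareFree n → q m n ≡ 1
  q≡1 {suc (suc m)} {n} _ sf
    with Fin.any? {n = suc n} (λ i → prime? (toℕ i) ×-dec ((toℕ i ^ suc (suc m)) ∣? n))
  ... | no  _                       = refl
  ... | yes (i , prime[i] , iᵐ∣n) = contradiction
    (∣-trans (subst (toℕ i * toℕ i ∣_) (*-assoc (toℕ i) (toℕ i) (toℕ i ^ m)) (m∣m*n _)) iᵐ∣n)
    (sf (toℕ i) (prime⇒2≤ prime[i]))
  q≡1 {suc zero} (s≤s ())

  separate-residues : ∀ {m K r r′} → 2 ≤ m → .{{NonZero K}} → Coprime r K → r < r′ →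
    ∃ λ t → 1 ≤ t × q m (K * t + r) ≡ 1 × q m (K * t + r′) ≡ 0
  separate-residues {m} {K} {r} {r′} 2≤m r⊥K r<r′ =
    let t , n , 1≤t , position , squareFree , killed =
          -- The survivor is r + K t itself, at the start of a window of length r′ - r; the far end
          -- of the window is K t + r′.
          Isolation.isolate m (<⇒≤ 2≤m) 1 K r (r′ ∸ r) 0 r⊥K z≤n
        P , prime[P] , _ , Pᵐ∣n+gap = killed (r′ ∸ r) ≤-refl (m>n⇒m∸n≢0 r<r′)
    in t , 1≤t , q≡1 2≤m (subst SquareFree (+-comm r (K * t)) squareFree) ,
       q≡0 (<⇒≤ 2≤m) prime[P] (≤-trans (≤-trans (s≤s z≤n) r<r′) (m≤n+m r′ (K * t)))
         (subst (P ^ m ∣_) (n+gap≡Kt+r′ t n position) Pᵐ∣n+gap)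
    where
    rotate : ∀ a b c → a + b + c ≡ b + (a + c)
    rotate = solve-∀
    n+gap≡Kt+r′ : ∀ t n → n + 0 ≡ 1 * (r + K * t) → n + (r′ ∸ r) ≡ K * t + r′
    n+gap≡Kt+r′ t n position = begin
      n + (r′ ∸ r)            ≡⟨ cong (_+ (r′ ∸ r)) (trans (sym (+-identityʳ n)) (trans position (*-identityˡ _))) ⟩
      r + K * t + (r′ ∸ r)    ≡⟨ rotate r (K * t) (r′ ∸ r) ⟩
      K * t + (r + (r′ ∸ r))  ≡⟨ cong (K * t +_) (m+[n∸m]≡n (<⇒≤ r<r′)) ⟩
      K * t + r′              ∎
      where open ≡-Reasoning

  -- Among the N + 1 residues 1 + k i modulo k ^ (N + 1), all coprime to k, two must give
  -- the same element of an N-element kernel.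
  ¬automatic : ∀ {m k} → 2 ≤ m → 2 ≤ k → ¬ Automatic k (q m)
  ¬automatic {m} {k} 2≤m 2≤k (N , S , kernel) =
    let i , j , i<j , class≡ = Fin.pigeonhole ≤-refl class
        t , 1≤t , q≡1ᵢ , q≡0ⱼ = separate-residues 2≤m {{kˡ≢0}} (residue-coprime i) (s<s (*-monoʳ-< k {{k≢0}} i<j))
    in contradiction (let open ≡-Reasoning in begin
         1                                  ≡⟨ q≡1ᵢ ⟨
         q m (k ^ suc N * t + residue i)    ≡⟨ proj₂ (kernel (suc N) (residue i) (residue< i)) t 1≤t ⟩
         S (class i) t                      ≡⟨ cong (λ a → S a t) class≡ ⟩
         S (class j) t                      ≡⟨ proj₂ (kernel (suc N) (residue j) (residue< j)) t 1≤t ⟨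
         q m (k ^ suc N * t + residue j)    ≡⟨ q≡0ⱼ ⟩
         0                                  ∎) λ ()
    where
    k≢0 : NonZero k
    k≢0 = >-nonZero (<⇒≤ 2≤k)
    kˡ≢0 : NonZero (k ^ suc N)
    kˡ≢0 = m^n≢0 k (suc N) {{k≢0}}

    residue : Fin (suc N) → ℕ
    residue i = 1 + k * toℕ i

    -- Level N + 1 suffices because N < k ^ N gives k (N + 1) ≤ k ^ (N + 1).
    residue< : ∀ i → residue i < k ^ suc N
    residue< i = begin-strict
      1 + k * toℕ i     <⟨ +-monoˡ-< _ 2≤k ⟩
      k + k * toℕ i     ≡⟨ sym (*-suc k (toℕ i)) ⟩
      k * suc (toℕ i)   ≤⟨ *-monoʳ-≤ k (≤-trans (Fin.toℕ<n i) (n<k^n N 2≤k)) ⟩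
      k * k ^ N         ∎
      where open ≤-Reasoning

    residue-coprime : ∀ i → Coprime (residue i) (k ^ suc N)
    residue-coprime i = coprime-^ {p = k} (suc N) λ { {d} (d∣r , d∣k) →
      ∣1⇒≡1 (∣m+n∣m⇒∣n (subst (d ∣_) (+-comm 1 _) d∣r) (∣m⇒∣m*n (toℕ i) d∣k)) }

    class : Fin (suc N) → Fin N
    class i = proj₁ (kernel (suc N) (residue i) (residue< i))

open Arithmetic

-- The Frobenius and linear dependence in commutative rings

open import Level using (_⊔_)

prime∤! : ∀ {p} → Prime p → ∀ k → k ℕ.< p → ¬ p ∣ k !
prime∤! prime[p] zero    _   p∣1 = prime∤1 prime[p] p∣1
prime∤! prime[p] (suc k) k<p p∣ with euclidsLemma (suc k) (k !) prime[p] p∣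
... | inj₁ p∣1+k = ℕ.<⇒≱ k<p (ℕ∣.∣⇒≤ p∣1+k)
... | inj₂ p∣k!  = prime∤! prime[p] k (ℕ.<-trans (ℕ.n<1+n k) k<p) p∣k!

binomial*factorials : ∀ {p k} → k ℕ.≤ p → (p C k) ℕ.* (k ! ℕ.* (p ℕ.∸ k) !) ≡ p !
binomial*factorials {p} {k} k≤p =
  ≡.trans (≡.cong (ℕ._* (k ! ℕ.* (p ℕ.∸ k) !)) (nCk≡n!/k![n-k]! k≤p)) (m/n*n≡m (k![n∸k]!∣n! k≤p))
  where
  instance
    _ : ℕ.NonZero (k ! ℕ.* (p ℕ.∸ k) !)
    _ = k ℕ.!* (p ℕ.∸ k) !≢0

prime∣binomial : ∀ {p k} → Prime p → 0 ℕ.< k → k ℕ.< p → p ∣ p C k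
prime∣binomial {p} {k} prime[p] 0<k k<p
  with euclidsLemma (p C k) _ prime[p] (≡.subst (p ∣_) (≡.sym (binomial*factorials (ℕ.<⇒≤ k<p)))
         (n∣n! p (ℕ.≤-trans (s≤s z≤n) k<p)))
... | inj₁ p∣C = p∣C
... | inj₂ p∣k![p-k]! with euclidsLemma (k !) ((p ℕ.∸ k) !) prime[p] p∣k![p-k]!
...   | inj₁ p∣k!     = contradiction p∣k! (prime∤! prime[p] k k<p)
...   | inj₂ p∣[p-k]! = contradiction p∣[p-k]!
  (prime∤! prime[p] (p ℕ.∸ k) (ℕ.∸-monoʳ-< 0<k (ℕ.<⇒≤ k<p)))

-- Kept general because it is applied to two rings: the integers modulo p, where it yields Fermat's
-- little theorem, and the power series over them, where it yields the Frobenius.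
module FreshmansDream {c ℓ} (R : CommutativeRing c ℓ) where
  open CommutativeRing R hiding (zero)
  open import Algebra.Properties.Semiring.Exp semiring using (_^_)
  open import Algebra.Properties.Semiring.Mult semiring using (×-cong; ×-congʳ; ×-assocˡ; ×-assoc-*; ×-homo-1)
    renaming (_×_ to _·_)
  open import Algebra.Properties.CommutativeMonoid.Sum +-commutativeMonoid
    using (sum; sum-cong-≋; sum-replicate-zero; sum-init-last)
  open import Algebra.Properties.CommutativeSemiring.Binomial commutativeSemiring
    using (theorem; binomial; binomialTerm)
  open import Relation.Binary.Reasoning.Setoid setoid

  ∣⇒·≈0 : ∀ {p n} → p · 1# ≈ 0# → p ∣ n → ∀ x → n · x ≈ 0#
  ∣⇒·≈0 {p} p·1≈0 (divides k ≡.refl) x = begin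
    (k ℕ.* p) · x    ≡⟨ ≡.cong (_· x) (ℕ.*-comm k p) ⟩
    (p ℕ.* k) · x    ≈⟨ ×-assocˡ x p k ⟨
    p · (k · x)      ≈⟨ ×-congʳ p (*-identityˡ _) ⟨
    p · (1# * k · x) ≈⟨ ×-assoc-* p 1# (k · x) ⟨
    (p · 1#) * k · x ≈⟨ *-congʳ p·1≈0 ⟩
    0# * k · x       ≈⟨ zeroˡ _ ⟩
    0#               ∎

  freshmans-dream : ∀ {p} → Prime p → p · 1# ≈ 0# → ∀ x y → (x + y) ^ p ≈ x ^ p + y ^ p
  freshmans-dream {0} prime[p] = contradiction (prime⇒2≤ prime[p]) λ ()
  freshmans-dream {1} prime[p] = contradiction (prime⇒2≤ prime[p]) λ { (s≤s ()) }
  freshmans-dream {p@(suc (suc p-2))} prime[p] p·1≈0 x y = begin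
    (x + y) ^ p                                                 ≈⟨ theorem p x y ⟩
    term zero + sum (term ∘ suc)                                ≈⟨ +-congˡ (sum-init-last (term ∘ suc)) ⟩
    term zero + (sum (term ∘ suc ∘ inject₁) + term (fromℕ p))   ≈⟨ +-cong first (+-cong middle last) ⟩
    y ^ p + (0# + x ^ p)                                        ≈⟨ +-congˡ (+-identityˡ _) ⟩
    y ^ p + x ^ p                                               ≈⟨ +-comm _ _ ⟩
    x ^ p + y ^ p                                               ∎
    where
    term = binomialTerm x y p
    first : term zero ≈ y ^ p
    first = begin
      (p C 0) · (1# * y ^ p)  ≈⟨ ×-cong (≡.trans (nCk≡nC[n∸k] {n = p} z≤n) (nCn≡1 p)) (*-identityˡ _) ⟩
      1 · y ^ p               ≈⟨ ×-homo-1 _ ⟩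
      y ^ p                   ∎
    middle : sum (term ∘ suc ∘ inject₁) ≈ 0#
    middle = trans (sum-cong-≋ λ i → ∣⇒·≈0 p·1≈0 (prime∣binomial prime[p] z<s (s<s (toℕ-inject₁< i))) (binomial x y p (suc (inject₁ i))))
      (sum-replicate-zero (suc p-2))
      where
      toℕ-inject₁< : ∀ (i : Fin (suc p-2)) → toℕ (inject₁ i) ℕ.< suc p-2
      toℕ-inject₁< i = ≡.subst (ℕ._< suc p-2) (≡.sym (Fin.toℕ-inject₁ i)) (Fin.toℕ<n i)
    last : term (fromℕ p) ≈ x ^ p
    last = begin
      (p C toℕ (fromℕ p)) · (x ^ toℕ (fromℕ p) * y ^ (p ℕ.∸ toℕ (fromℕ p)))
        ≡⟨ ≡.cong (λ k → (p C k) · (x ^ k * y ^ (p ℕ.∸ k))) (Fin.toℕ-fromℕ p) ⟩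
      (p C p) · (x ^ p * y ^ (p ℕ.∸ p))
        ≈⟨ ×-cong (nCn≡1 p) (*-congˡ (reflexive (≡.cong (y ^_) (ℕ.n∸n≡0 p)))) ⟩
      1 · (x ^ p * 1#)  ≈⟨ ×-homo-1 _ ⟩
      x ^ p * 1#        ≈⟨ *-identityʳ _ ⟩
      x ^ p             ∎

-- Q singles out the coefficients, later the polynomials among the power series.
record CoefficientRing {c ℓ} (R : CommutativeRing c ℓ) q : Set (c ⊔ ℓ ⊔ Level.suc q) where
  open CommutativeRing R
  field
    Q                : Carrier → Set q
    Q-1              : Q 1#
    Q-0              : Q 0#
    Q-+              : ∀ {x y} → Q x → Q y → Q (x + y)
    Q-*              : ∀ {x y} → Q x → Q y → Q (x * y)
    Q-neg            : ∀ {x} → Q x → Q (- x)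
    _≈0?             : ∀ {x} → Q x → Dec (x ≈ 0#)
    1≉0              : ¬ 1# ≈ 0#
    no-zero-divisors : ∀ {x y} → ¬ x ≈ 0# → ¬ y ≈ 0# → ¬ x * y ≈ 0#

module LinearDependence {c ℓ q} (R : CommutativeRing c ℓ) (coefficients : CoefficientRing R q) where
  open CommutativeRing R hiding (zero)
  open CoefficientRing coefficients
  open import Algebra.Properties.Semiring.Exp semiring using (_^_)
  open import Algebra.Properties.CommutativeMonoid.Sum +-commutativeMonoid
    using (sum; sum-cong-≋; sum-replicate-zero; sum-remove; ∑-distrib-+)
  open import Algebra.Properties.Semiring.Sum semiring using (*-distribʳ-sum)
  open import Algebra.Properties.Ring ring
    using (-1*x≈-x)
  open import Relation.Binary.Reasoning.Setoid setoid

  open import Algebra.Properties.CommutativeSemigroup +-commutativeSemigroup as + using ()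
  open import Algebra.Properties.CommutativeSemigroup *-commutativeSemigroup as * using ()

  Span : List Carrier → Carrier → Set (c ⊔ ℓ ⊔ q)
  Span []       x = Lift (c ⊔ q) (x ≈ 0#)
  Span (g ∷ gs) x = ∃₂ λ v y → Q v × Span gs y × x ≈ v * g + y

  Span-resp : ∀ gs {x y} → x ≈ y → Span gs x → Span gs y
  Span-resp []       x≈y (lift x≈0)           = lift (trans (sym x≈y) x≈0)
  Span-resp (g ∷ gs) x≈y (v , z , Qv , span-z , x≈) = v , z , Qv , span-z , trans (sym x≈y) x≈

  Span-0 : ∀ gs → Span gs 0#
  Span-0 []       = lift refl
  Span-0 (g ∷ gs) = 0# , 0# , Q-0 , Span-0 gs , sym (trans (+-identityʳ _) (zeroˡ g))

  Span-+ : ∀ gs {x y} → Span gs x → Span gs y → Span gs (x + y)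
  Span-+ [] (lift x≈0) (lift y≈0) = lift (trans (+-cong x≈0 y≈0) (+-identityˡ 0#))
  Span-+ (g ∷ gs) (v , x′ , Qv , span-x′ , x≈) (w , y′ , Qw , span-y′ , y≈) =
    v + w , x′ + y′ , Q-+ Qv Qw , Span-+ gs span-x′ span-y′ , trans (+-cong x≈ y≈) (trans (+.interchange _ _ _ _) (+-congʳ (sym (distribʳ g v w))))

  Span-* : ∀ gs {a x} → Q a → Span gs x → Span gs (a * x)
  Span-* [] Qa (lift x≈0) = lift (trans (*-congˡ x≈0) (zeroʳ _))
  Span-* (g ∷ gs) {a} Qa (v , y , Qv , span-y , x≈) =
    a * v , a * y , Q-* Qa Qv , Span-* gs Qa span-y , trans (*-congˡ x≈) (trans (distribˡ a _ _) (+-congʳ (sym (*-assoc a v g))))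

  Span-neg : ∀ gs {x} → Span gs x → Span gs (- x)
  Span-neg gs span-x = Span-resp gs (-1*x≈-x _) (Span-* gs (Q-neg Q-1) span-x)

  Span-head : ∀ {g} gs → Span (g ∷ gs) g
  Span-head {g} gs = 1# , 0# , Q-1 , Span-0 gs , sym (trans (+-identityʳ _) (*-identityˡ g))

  Span-weaken : ∀ {g} gs {x} → Span gs x → Span (g ∷ gs) x
  Span-weaken {g} gs {x} span-x = 0# , x , Q-0 , span-x , sym (trans (+-congʳ (zeroˡ g)) (+-identityˡ x))

  Span-map : ∀ {b} gs hs {x} → All (λ g → Span hs (b * g)) gs → Span gs x → Span hs (b * x)
  Span-map [] hs [] (lift x≈0) = Span-resp hs (sym (trans (*-congˡ x≈0) (zeroʳ _))) (Span-0 hs)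
  Span-map {b} (g ∷ gs) hs (span-bg ∷ span-bgs) (v , y , Qv , span-y , x≈) =
    Span-resp hs (sym (trans (*-congˡ x≈) (trans (distribˡ b _ _) (+-congʳ (*.x∙yz≈y∙xz b v g)))))
      (Span-+ hs (Span-* hs Qv span-bg) (Span-map gs hs span-bgs span-y))

  sum-zero : ∀ {n} {t : Fin n → Carrier} → (∀ i → t i ≈ 0#) → sum t ≈ 0#
  sum-zero {n} t≈0 = trans (sum-cong-≋ t≈0) (sum-replicate-zero n)

  Q-sum : ∀ {n} {t : Fin n → Carrier} → (∀ i → Q (t i)) → Q (sum t)
  Q-sum {zero}  Qt = Q-0
  Q-sum {suc n} Qt = Q-+ (Qt zero) (Q-sum (Qt ∘ suc))

  Dependent : ∀ {n} → (Fin n → Carrier) → Set (c ⊔ ℓ ⊔ q)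
  Dependent {n} xs = ∃ λ (c : Fin n → Carrier) → (∀ i → Q (c i)) × (∃ λ i → ¬ c i ≈ 0#) × sum (λ i → c i * xs i) ≈ 0#

  -- A relation among the combinations b xᵢ + wᵢ xₖ is one among the xᵢ themselves: xᵢ receives cᵢ b
  -- and xₖ collects Σ cᵢ wᵢ. It remains nontrivial because b is nonzero in a domain.
  dependent-pivot : ∀ {n} (xs : Fin (suc n) → Carrier) k b (w : Fin n → Carrier) →
    Q b → ¬ b ≈ 0# → (∀ i → Q (w i)) →
    Dependent (λ i → b * xs (punchIn k i) + w i * xs k) → Dependent xs
  dependent-pivot xs k b w Qb b≉0 Qw (c , Qc , (i₀ , cᵢ≉0) , relation) =
    c′ , Qc′ , (punchIn k i₀ , c′≉0) , relation′
    where
    pivot = sum (λ i → c i * w i)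
    c′ = insertAt (λ i → c i * b) k pivot
    c′-pivot : c′ k ≡ pivot
    c′-pivot = insertAt-lookup _ k _
    c′-other : ∀ i → c′ (punchIn k i) ≡ c i * b
    c′-other = insertAt-punchIn _ k _
    c′≉0 : ¬ c′ (punchIn k i₀) ≈ 0#
    c′≉0 eq = no-zero-divisors cᵢ≉0 b≉0 (trans (sym (reflexive (c′-other i₀))) eq)
    Qc′ : ∀ i → Q (c′ i)
    Qc′ i with k Fin.≟ i
    ... | yes ≡.refl = ≡.subst Q (≡.sym c′-pivot) (Q-sum λ i → Q-* (Qc i) (Qw i))
    ... | no  k≢i    = ≡.subst (Q ∘ c′) (Fin.punchIn-punchOut k≢i)
      (≡.subst Q (≡.sym (c′-other (Fin.punchOut k≢i))) (Q-* (Qc _) Qb))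
    regroup : ∀ c w x b y → c * w * x + c * b * y ≈ c * (b * y + w * x)
    regroup c w x b y = begin
      c * w * x + c * b * y       ≈⟨ +-cong (*-assoc c w x) (*-assoc c b y) ⟩
      c * (w * x) + c * (b * y)   ≈⟨ distribˡ c _ _ ⟨
      c * (w * x + b * y)         ≈⟨ *-congˡ (+-comm _ _) ⟩
      c * (b * y + w * x)         ∎
    relation′ : sum (λ i → c′ i * xs i) ≈ 0#
    relation′ = begin
      sum (λ i → c′ i * xs i)
        ≈⟨ sum-remove {i = k} (λ i → c′ i * xs i) ⟩
      c′ k * xs k + sum (λ i → c′ (punchIn k i) * xs (punchIn k i))
        ≈⟨ +-cong (*-congʳ (reflexive c′-pivot)) (sum-cong-≋ λ i → *-congʳ (reflexive (c′-other i))) ⟩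
      pivot * xs k + sum (λ i → c i * b * xs (punchIn k i))
        ≈⟨ +-congʳ (*-distribʳ-sum (xs k) (λ i → c i * w i)) ⟩
      sum (λ i → c i * w i * xs k) + sum (λ i → c i * b * xs (punchIn k i))
        ≈⟨ ∑-distrib-+ (λ i → c i * w i * xs k) (λ i → c i * b * xs (punchIn k i)) ⟨
      sum (λ i → c i * w i * xs k + c i * b * xs (punchIn k i))
        ≈⟨ sum-cong-≋ (λ i → regroup (c i) (w i) (xs k) b (xs (punchIn k i))) ⟩
      sum (λ i → c i * (b * xs (punchIn k i) + w i * xs k))
        ≈⟨ relation ⟩
      0# ∎

  -- Fraction-free Gaussian elimination. If some xₖ has a nonzero coefficient vₖ at g, the
  -- combinations vₖ xᵢ - vᵢ xₖ no longer involve g, so one generator and one vector are removed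
  -- together.
  too-many-dependent : ∀ gs (xs : Fin (suc (length gs)) → Carrier) → (∀ i → Span gs (xs i)) → Dependent xs
  too-many-dependent [] xs span-xs = (λ _ → 1#) , (λ _ → Q-1) , (zero , 1≉0) ,
    sum-zero {1} {λ i → 1# * xs i} λ { zero → trans (*-identityˡ _) (lower (span-xs zero)) }
  too-many-dependent (g ∷ gs) xs span-xs with Fin.any? (λ i → ¬? (proj₁ (proj₂ (proj₂ (span-xs i))) ≈0?))
  -- Here g does not occur at all; the first vector is given coefficient 0 so that the count still
  -- matches the remaining generators.
  ... | no ∄pivot =
    let c , Qc , (i₀ , cᵢ≉0) , relation = too-many-dependent gs (xs ∘ suc) λ i →
          let v , y , Qv , span-y , x≈ = span-xs (suc i)
              v≈0 = decidable-stable (Qv ≈0?) (λ v≉0 → ∄pivot (suc i , v≉0))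
          in Span-resp gs (sym (trans x≈ (trans (+-congʳ (trans (*-congʳ v≈0) (zeroˡ g))) (+-identityˡ y)))) span-y
    in (λ { zero → 0# ; (suc i) → c i }) , (λ { zero → Q-0 ; (suc i) → Qc i }) ,
       (suc i₀ , cᵢ≉0) , trans (+-cong (zeroˡ _) relation) (+-identityˡ 0#)
  ... | yes (k , vₖ≉0) =
    dependent-pivot xs k (v k) (λ i → - v (punchIn k i)) (Qv k) vₖ≉0 (λ i → Q-neg (Qv (punchIn k i)))
      (too-many-dependent gs _ λ i → Span-resp gs (sym (eliminate (punchIn k i)))
        (Span-+ gs (Span-* gs (Qv k) (span-y (punchIn k i)))
                   (Span-* gs (Q-neg (Qv (punchIn k i))) (span-y k))))
    where
    v = λ i → proj₁ (span-xs i)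
    y = λ i → proj₁ (proj₂ (span-xs i))
    Qv : ∀ i → Q (v i)
    Qv i = proj₁ (proj₂ (proj₂ (span-xs i)))
    span-y = λ i → proj₁ (proj₂ (proj₂ (proj₂ (span-xs i))))
    x≈ : ∀ i → xs i ≈ v i * g + y i
    x≈ i = proj₂ (proj₂ (proj₂ (proj₂ (span-xs i))))
    eliminate : ∀ i → v k * xs i + - v i * xs k ≈ v k * y i + - v i * y k
    eliminate i = begin
      v k * xs i + - v i * xs k
        ≈⟨ +-cong (*-congˡ (x≈ i)) (*-congˡ (x≈ k)) ⟩
      v k * (v i * g + y i) + - v i * (v k * g + y k)
        ≈⟨ trans (+-cong (distribˡ (v k) _ _) (distribˡ (- v i) _ _)) (+.interchange _ _ _ _) ⟩
      (v k * (v i * g) + - v i * (v k * g)) + (v k * y i + - v i * y k)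
        ≈⟨ trans (+-comm _ _) (+-congˡ (+-congʳ (*.x∙yz≈y∙xz (v k) (v i) g))) ⟩
      (v k * y i + - v i * y k) + (v i * (v k * g) + - v i * (v k * g))
        ≈⟨ +-congˡ (distribʳ (v k * g) (v i) (- v i)) ⟨
      (v k * y i + - v i * y k) + (v i - v i) * (v k * g)
        ≈⟨ +-congˡ (trans (*-congʳ (-‿inverseʳ _)) (zeroˡ _)) ⟩
      (v k * y i + - v i * y k) + 0#
        ≈⟨ +-identityʳ _ ⟩
      v k * y i + - v i * y k ∎

  nonzero? : ∀ {As} → All Q As → Dec (Any (λ A → ¬ A ≈ 0#) As)
  nonzero? []         = no λ ()
  nonzero? (QA ∷ QAs) with QA ≈0? | nonzero? QAs
  ... | no  A≉0 | _       = yes (here A≉0)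
  ... | yes _   | yes any = yes (there any)
  ... | yes A≈0 | no ¬any = no λ { (here A≉0) → A≉0 A≈0 ; (there any) → ¬any any }

  -- Powers of an algebraic element

  module _ (f : Carrier) where

    powers : ℕ → ℕ → List Carrier
    powers j zero    = []
    powers j (suc d) = f ^ j ∷ powers (suc j) d

    evaluate : ℕ → List Carrier → Carrier
    evaluate j []       = 0#
    evaluate j (A ∷ As) = A * f ^ j + evaluate (suc j) As

    -- The list may end in zero coefficients, so the actual degree is found by testing at each entry
    -- whether the tail is zero.
    leading-term : ∀ j {As} → All Q As → Any (λ A → ¬ A ≈ 0#) As →
      ∃₂ λ d a → Q a × ¬ a ≈ 0# × ∃ λ y → Span (powers j d) y × evaluate j As ≈ a * f ^ (j ℕ.+ d) + y
    leading-term j {A ∷ As} (QA ∷ QAs) A≉0∷ with nonzero? QAs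
    ... | yes As≉0 =
      let d , a , Qa , a≉0 , y , span-y , eq = leading-term (suc j) QAs As≉0
      in suc d , a , Qa , a≉0 , A * f ^ j + y , (A , y , QA , span-y , refl) , (begin
        A * f ^ j + evaluate (suc j) As                 ≈⟨ +-congˡ eq ⟩
        A * f ^ j + (a * f ^ (suc j ℕ.+ d) + y)         ≈⟨ +.x∙yz≈y∙xz (A * f ^ j) _ y ⟩
        a * f ^ (suc j ℕ.+ d) + (A * f ^ j + y)         ≡⟨ ≡.cong (λ k → a * f ^ k + (A * f ^ j + y)) (≡.sym (ℕ.+-suc j d)) ⟩
        a * f ^ (j ℕ.+ suc d) + (A * f ^ j + y)         ∎)
    ... | no As≈0 with A≉0∷
    ...   | there As≉0 = contradiction As≉0 As≈0
    ...   | here A≉0   = 0 , A , QA , A≉0 , 0# , lift refl , +-cong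
      (*-congˡ (reflexive (≡.cong (f ^_) (≡.sym (ℕ.+-identityʳ j))))) (evaluate≈0 (suc j) QAs As≈0)
      where
      evaluate≈0 : ∀ j {As} → All Q As → ¬ Any (λ A → ¬ A ≈ 0#) As → evaluate j As ≈ 0#
      evaluate≈0 j []         _    = refl
      evaluate≈0 j (QA ∷ QAs) As≈0 = trans (+-cong
        (trans (*-congʳ (decidable-stable (QA ≈0?) (As≈0 ∘ here))) (zeroˡ _))
        (evaluate≈0 (suc j) QAs (As≈0 ∘ there))) (+-identityˡ 0#)

    -- Multiplication by a f moves each power to its successor, again a listed power except at the
    -- end of the list, where `top`, the equation of f solved for its leading term, brings it back
    -- into the span.
    Span-powers-shift : ∀ j d gs {a} → Q a → All (Span gs) (powers j d) → Span gs (a * f ^ (j ℕ.+ d)) →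
      All (λ g → Span gs (a * f * g)) (powers j d)
    Span-powers-shift j zero gs Qa [] top = []
    Span-powers-shift j (suc zero) gs Qa (_ ∷ []) top = Span-resp gs
      (trans (*-congˡ (reflexive (≡.cong (f ^_) (ℕ.+-comm j 1)))) (sym (*-assoc _ f _))) top ∷ []
    Span-powers-shift j (suc (suc d)) gs {a} Qa (_ ∷ p ∷ ps) top =
      Span-resp gs (sym (*-assoc _ f _)) (Span-* gs Qa p) ∷
      Span-powers-shift (suc j) (suc d) gs Qa (p ∷ ps) (≡.subst (λ k → Span gs (a * f ^ k)) (ℕ.+-suc j (suc d)) top)

    Span-powers : ∀ j d → All (Span (powers j d)) (powers j d)
    Span-powers j zero    = []
    Span-powers j (suc d) = Span-head _ ∷ weaken (Span-powers (suc j) d)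
      where
      weaken : ∀ {xs} → All (Span (powers (suc j) d)) xs → All (Span (powers j (suc d))) xs
      weaken []       = []
      weaken (s ∷ ss) = Span-weaken _ s ∷ weaken ss

    -- a ^ n would not do: for d = n = 0 the span is zero.
    high-power : ∀ d {a} → Q a → Span (powers 0 d) (a * f ^ d) → ∀ n → Span (powers 0 d) (a ^ suc n * f ^ n)
    high-power zero {a} Qa top zero = Span-resp [] (*-congʳ (sym (*-identityʳ a))) top
    high-power (suc d) Qa top zero =
      Span-* (powers 0 (suc d)) (Q-* Qa Q-1) (Span-head (powers 1 d))
    high-power d {a} Qa top (suc n) = Span-resp (powers 0 d) (*.interchange a f (a ^ suc n) (f ^ n))
      (Span-map (powers 0 d) (powers 0 d) (Span-powers-shift 0 d (powers 0 d) Qa (Span-powers 0 d) top)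
        (high-power d Qa top n))

    Q-^ : ∀ {a} → Q a → ∀ n → Q (a ^ n)
    Q-^ Qa zero    = Q-1
    Q-^ Qa (suc n) = Q-* Qa (Q-^ Qa n)

    ^≉0 : ∀ {a} → ¬ a ≈ 0# → ∀ n → ¬ a ^ n ≈ 0#
    ^≉0 a≉0 zero    = 1≉0
    ^≉0 a≉0 (suc n) = no-zero-divisors a≉0 (^≉0 a≉0 n)

    length-powers : ∀ j d → length (powers j d) ≡ d
    length-powers j zero    = ≡.refl
    length-powers j (suc d) = ≡.cong suc (length-powers (suc j) d)

    -- The d + 1 elements a ^ (e i + 1) f ^ (e i) lie in a module with d generators. The powers of a
    -- stand in for division by the leading coefficient; in the resulting relation they are absorbed
    -- into the coefficients.
    algebraic⇒powers-dependent : ∀ {As} → All Q As → Any (λ A → ¬ A ≈ 0#) As → evaluate 0 As ≈ 0# →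
      ∀ (e : ℕ → ℕ) → ∃ λ n → Dependent {n} (λ i → f ^ e (toℕ i))
    algebraic⇒powers-dependent QAs As≉0 root e =
      let d , a , Qa , a≉0 , y , span-y , eq = leading-term 0 QAs As≉0
          top : Span (powers 0 d) (a * f ^ d)
          top = Span-resp (powers 0 d) (sym (begin
            a * f ^ d              ≈⟨ +-identityʳ _ ⟨
            a * f ^ d + 0#         ≈⟨ +-congˡ (-‿inverseʳ y) ⟨
            a * f ^ d + (y - y)    ≈⟨ +-assoc _ _ _ ⟨
            a * f ^ d + y - y      ≈⟨ +-congʳ (trans (sym eq) root) ⟩
            0# - y                 ≈⟨ +-identityˡ _ ⟩
            - y                    ∎)) (Span-neg (powers 0 d) span-y)
          c , Qc , (i , cᵢ≉0) , relation = too-many-dependent (powers 0 d) _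
            λ i → high-power d Qa top (e (toℕ i))
      in _ , (λ i → c i * a ^ suc (e (toℕ i))) , (λ i → Q-* (Qc i) (Q-^ Qa (suc (e (toℕ i))))) ,
         (i , no-zero-divisors cᵢ≉0 (^≉0 a≉0 (suc (e (toℕ i))))) ,
         trans (sum-cong-≋ λ i → *-assoc (c i) (a ^ suc (e (toℕ i))) (f ^ e (toℕ i))) relation

-- Formal power series

module PowerSeries {c ℓ} (R : CommutativeRing c ℓ) where
  open CommutativeRing R hiding (zero)
  open import Algebra.Properties.CommutativeSemigroup +-commutativeSemigroup as + using ()
  open import Relation.Binary.Reasoning.Setoid setoid

  Series : Set c
  Series = ℕ → Carrier

  infix  4 _≋_
  infixl 7 _⊛_
  infixl 6 _⊕_

  _≋_ : Series → Series → Set ℓ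
  f ≋ g = ∀ n → f n ≈ g n

  -- The Cauchy product, by recursion through f = f₀ + X f⁺ with f⁺ = `f ∘ suc`; this form lets the
  -- ring laws be proved by induction on the index.
  _⊕_ _⊛_ : Series → Series → Series
  (f ⊕ g) n = f n + g n
  (f ⊛ g) zero    = f 0 * g 0
  (f ⊛ g) (suc n) = f 0 * g (suc n) + (f ∘ suc ⊛ g) n

  constant : Carrier → Series
  constant x zero    = x
  constant x (suc _) = 0#

  ⊛-cong : ∀ {f f′ g g′} → f ≋ f′ → g ≋ g′ → f ⊛ g ≋ f′ ⊛ g′
  ⊛-cong f≋ g≋ zero    = *-cong (f≋ 0) (g≋ 0)
  ⊛-cong f≋ g≋ (suc n) = +-cong (*-cong (f≋ 0) (g≋ (suc n))) (⊛-cong (f≋ ∘ suc) g≋ n)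

  ⊛-distribʳ : ∀ h f g → (f ⊕ g) ⊛ h ≋ (f ⊛ h) ⊕ (g ⊛ h)
  ⊛-distribʳ h f g zero    = distribʳ _ _ _
  ⊛-distribʳ h f g (suc n) = trans
    (+-cong (distribʳ _ _ _) (⊛-distribʳ h (f ∘ suc) (g ∘ suc) n)) (+.interchange _ _ _ _)

  -- The definition splits off the head of the first factor; this mirror image splits off that of
  -- the second, and commutativity compares the two.
  ⊛-suc : ∀ f g n → (f ⊛ g) (suc n) ≈ (f ⊛ (g ∘ suc)) n + f (suc n) * g 0
  ⊛-suc f g zero    = refl
  ⊛-suc f g (suc n) = trans (+-congˡ (⊛-suc (f ∘ suc) g n)) (sym (+-assoc _ _ _))

  ⊛-comm : ∀ f g → f ⊛ g ≋ g ⊛ f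
  ⊛-comm f g zero    = *-comm _ _
  ⊛-comm f g (suc n) = begin
    f 0 * g (suc n) + (f ∘ suc ⊛ g) n   ≈⟨ +-cong (*-comm _ _) (⊛-comm (f ∘ suc) g n) ⟩
    g (suc n) * f 0 + (g ⊛ f ∘ suc) n   ≈⟨ +-comm _ _ ⟩
    (g ⊛ f ∘ suc) n + g (suc n) * f 0   ≈⟨ ⊛-suc g f n ⟨
    (g ⊛ f) (suc n)                     ∎

  ⊛-distribˡ : ∀ h f g → h ⊛ (f ⊕ g) ≋ (h ⊛ f) ⊕ (h ⊛ g)
  ⊛-distribˡ h f g n = trans (⊛-comm h (f ⊕ g) n)
    (trans (⊛-distribʳ h f g n) (+-cong (⊛-comm f h n) (⊛-comm g h n)))

  scale-⊛ : ∀ x f g → (λ n → x * f n) ⊛ g ≋ λ n → x * (f ⊛ g) n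
  scale-⊛ x f g zero    = *-assoc _ _ _
  scale-⊛ x f g (suc n) = trans (+-cong (*-assoc _ _ _) (scale-⊛ x (f ∘ suc) g n)) (sym (distribˡ _ _ _))

  ⊛-assoc : ∀ f g h → (f ⊛ g) ⊛ h ≋ f ⊛ (g ⊛ h)
  ⊛-assoc f g h zero    = *-assoc _ _ _
  ⊛-assoc f g h (suc n) = begin
    f 0 * g 0 * h (suc n) + (((λ k → f 0 * g (suc k)) ⊕ (f ∘ suc ⊛ g)) ⊛ h) n
      ≈⟨ +-cong (*-assoc _ _ _) (⊛-distribʳ h (λ k → f 0 * g (suc k)) (f ∘ suc ⊛ g) n) ⟩
    f 0 * (g 0 * h (suc n)) + (((λ k → f 0 * g (suc k)) ⊛ h) n + ((f ∘ suc ⊛ g) ⊛ h) n)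
      ≈⟨ +-congˡ (+-cong (scale-⊛ (f 0) (g ∘ suc) h n) (⊛-assoc (f ∘ suc) g h n)) ⟩
    f 0 * (g 0 * h (suc n)) + (f 0 * (g ∘ suc ⊛ h) n + (f ∘ suc ⊛ (g ⊛ h)) n)
      ≈⟨ +-assoc _ _ _ ⟨
    f 0 * (g 0 * h (suc n)) + f 0 * (g ∘ suc ⊛ h) n + (f ∘ suc ⊛ (g ⊛ h)) n
      ≈⟨ +-congʳ (distribˡ _ _ _) ⟨
    (f ⊛ (g ⊛ h)) (suc n) ∎

  ⊛-vanishes : ∀ f g n → (∀ j k → j ℕ.+ k ≡ n → f j * g k ≈ 0#) → (f ⊛ g) n ≈ 0#
  ⊛-vanishes f g zero    fg≈0 = fg≈0 0 0 ≡.refl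
  ⊛-vanishes f g (suc n) fg≈0 = trans
    (+-cong (fg≈0 0 (suc n) ≡.refl) (⊛-vanishes (f ∘ suc) g n λ j k j+k≡n → fg≈0 (suc j) k (≡.cong suc j+k≡n)))
    (+-identityˡ 0#)

  ⊛-single : ∀ f g j₀ k₀ → (∀ j k → j ℕ.+ k ≡ j₀ ℕ.+ k₀ → j ≢ j₀ → f j * g k ≈ 0#) →
    (f ⊛ g) (j₀ ℕ.+ k₀) ≈ f j₀ * g k₀
  ⊛-single f g zero     zero     fg≈0 = refl
  ⊛-single f g zero     (suc k₀) fg≈0 = trans
    (+-congˡ (⊛-vanishes (f ∘ suc) g k₀ λ j k j+k≡k₀ → fg≈0 (suc j) k (≡.cong suc j+k≡k₀) λ ()))
    (+-identityʳ _)
  ⊛-single f g (suc j₀) k₀       fg≈0 = trans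
    (+-cong (fg≈0 0 (suc (j₀ ℕ.+ k₀)) ≡.refl λ ())
      (⊛-single (f ∘ suc) g j₀ k₀ λ j k eq j≢j₀ → fg≈0 (suc j) k (≡.cong suc eq) (j≢j₀ ∘ ℕ.suc-injective)))
    (+-identityˡ _)

  constant-⊛ : ∀ x g → constant x ⊛ g ≋ λ n → x * g n
  constant-⊛ x g n = ⊛-single (constant x) g 0 n λ
    { zero k _ 0≢0 → contradiction ≡.refl 0≢0 ; (suc j) k _ _ → zeroˡ _ }

  ⊛-identityˡ : ∀ g → constant 1# ⊛ g ≋ g
  ⊛-identityˡ g n = trans (constant-⊛ 1# g n) (*-identityˡ (g n))

  series : CommutativeRing c ℓ
  series = record
    { Carrier = Series
    ; _≈_ = _≋_
    ; _+_ = _⊕_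
    ; _*_ = _⊛_
    ; -_ = λ f n → - f n
    ; 0# = λ _ → 0#
    ; 1# = constant 1#
    ; isCommutativeRing = record
      { isRing = record
        { +-isAbelianGroup = record
          { isGroup = record
            { isMonoid = record
              { isSemigroup = record
                { isMagma = record
                  { isEquivalence = record
                    { refl = λ _ → refl
                    ; sym = λ f≋g n → sym (f≋g n)
                    ; trans = λ f≋g g≋h n → trans (f≋g n) (g≋h n) }
                  ; ∙-cong = λ f≋ g≋ n → +-cong (f≋ n) (g≋ n) }
                ; assoc = λ f g h n → +-assoc (f n) (g n) (h n) }
              ; identity = (λ f n → +-identityˡ (f n)) , (λ f n → +-identityʳ (f n)) }
            ; inverse = (λ f n → -‿inverseˡ (f n)) , (λ f n → -‿inverseʳ (f n))
            ; ⁻¹-cong = λ f≋ n → -‿cong (f≋ n) }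
          ; comm = λ f g n → +-comm (f n) (g n) }
        ; *-cong = ⊛-cong
        ; *-assoc = ⊛-assoc
        ; *-identity = ⊛-identityˡ , λ f n → trans (⊛-comm f (constant 1#) n) (⊛-identityˡ f n)
        ; distrib = ⊛-distribˡ , ⊛-distribʳ }
      ; *-comm = ⊛-comm } }

  FiniteSupport : Series → Set ℓ
  FiniteSupport f = ∃ λ D → ∀ n → D ℕ.≤ n → f n ≈ 0#

  FiniteSupport-constant : ∀ x → FiniteSupport (constant x)
  FiniteSupport-constant x = 1 , λ { (suc n) _ → refl }

  FiniteSupport-⊕ : ∀ {f g} → FiniteSupport f → FiniteSupport g → FiniteSupport (f ⊕ g)
  FiniteSupport-⊕ (D , f≈0) (E , g≈0) = D ℕ.⊔ E , λ n D⊔E≤n → trans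
    (+-cong (f≈0 n (ℕ.≤-trans (ℕ.m≤m⊔n D E) D⊔E≤n)) (g≈0 n (ℕ.≤-trans (ℕ.m≤n⊔m D E) D⊔E≤n)))
    (+-identityˡ 0#)

  FiniteSupport-⊛ : ∀ {f g} → FiniteSupport f → FiniteSupport g → FiniteSupport (f ⊛ g)
  FiniteSupport-⊛ {f} {g} (D , f≈0) (E , g≈0) = D ℕ.+ E , λ n D+E≤n → ⊛-vanishes f g n (term≈0 n D+E≤n)
    where
    term≈0 : ∀ n → D ℕ.+ E ℕ.≤ n → ∀ j k → j ℕ.+ k ≡ n → f j * g k ≈ 0#
    term≈0 n D+E≤n j k j+k≡n with D ℕ.≤? j | E ℕ.≤? k
    ... | yes D≤j | _       = trans (*-congʳ (f≈0 j D≤j)) (zeroˡ _)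
    ... | no  _   | yes E≤k = trans (*-congˡ (g≈0 k E≤k)) (zeroʳ _)
    ... | no  D≰j | no  E≰k = contradiction (≡.subst (D ℕ.+ E ℕ.≤_) (≡.sym j+k≡n) D+E≤n)
      (ℕ.<⇒≱ (ℕ.+-mono-< (ℕ.≰⇒> D≰j) (ℕ.≰⇒> E≰k)))

  FiniteSupport-neg : ∀ {f} → FiniteSupport f → FiniteSupport (λ n → - f n)
  FiniteSupport-neg (D , f≈0) = D , λ n D≤n → trans (-‿cong (f≈0 n D≤n)) -0#≈0#
    where open import Algebra.Properties.Ring ring using (-0#≈0#)

  module _ (_≈0? : ∀ x → Dec (x ≈ 0#)) where

    FiniteSupport-≋0? : ∀ {f} → FiniteSupport f → Dec (f ≋ λ _ → 0#)
    FiniteSupport-≋0? {f} (D , f≈0) with ℕ.anyUpTo? (λ n → ¬? (f n ≈0?)) D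
    ... | yes (n , _ , fn≉0) = no λ f≋0 → fn≉0 (f≋0 n)
    ... | no  ∄n = yes λ n → decidable-stable (f n ≈0?) λ fn≉0 → case-support n fn≉0
      where
      case-support : ∀ n → ¬ ¬ f n ≈ 0#
      case-support n fn≉0 with n ℕ.<? D
      ... | yes n<D = ∄n (n , n<D , fn≉0)
      ... | no  n≮D = fn≉0 (f≈0 n (ℕ.≮⇒≥ n≮D))

    module _ (domain : ∀ {x y} → ¬ x ≈ 0# → ¬ y ≈ 0# → ¬ x * y ≈ 0#) where

      -- The lowest nonzero coefficients of f and g multiply to a nonzero coefficient of the
      -- product. Leading zeros are stripped one at a time, and the known nonzero positions `i` and
      -- `j` bound the search.
      product-coefficient : ∀ f g i j → ¬ f i ≈ 0# → ¬ g j ≈ 0# → ∃ λ n → ¬ (f ⊛ g) n ≈ 0#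
      product-coefficient f g i j fi≉0 gj≉0 with f 0 ≈0? | g 0 ≈0?
      ... | no  f₀≉0 | no g₀≉0 = 0 , domain f₀≉0 g₀≉0
      product-coefficient f g zero    j fi≉0 gj≉0 | yes f₀≈0 | _ = contradiction f₀≈0 fi≉0
      product-coefficient f g (suc i) j fi≉0 gj≉0 | yes f₀≈0 | _ =
        let n , fg≉0 = product-coefficient (f ∘ suc) g i j fi≉0 gj≉0 in suc n , λ eq →
          fg≉0 (trans (sym (trans (+-congʳ (trans (*-congʳ f₀≈0) (zeroˡ _))) (+-identityˡ _))) eq)
      product-coefficient f g i zero    fi≉0 gj≉0 | no _ | yes g₀≈0 = contradiction g₀≈0 gj≉0
      product-coefficient f g i (suc j) fi≉0 gj≉0 | no _ | yes g₀≈0 =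
        let n , fg≉0 = product-coefficient f (g ∘ suc) i j fi≉0 gj≉0 in suc n , λ eq →
          fg≉0 (trans (sym (trans (⊛-suc f g n) (trans (+-congˡ (trans (*-congˡ g₀≈0) (zeroʳ _))) (+-identityʳ _)))) eq)

      ⊛-domain : ∀ {f g} → ¬ f ≋ (λ _ → 0#) → ¬ g ≋ (λ _ → 0#) → ¬ f ⊛ g ≋ (λ _ → 0#)
      ⊛-domain {f} {g} f≉0 g≉0 fg≈0 =
        f≉0 λ i → decidable-stable (f i ≈0?) λ fi≉0 →
        g≉0 λ j → decidable-stable (g j ≈0?) λ gj≉0 →
        let n , fg≉0 = product-coefficient f g i j fi≉0 gj≉0 in fg≉0 (fg≈0 n)

  -- The Frobenius on power series

  open import Algebra.Properties.Semiring.Exp semiring using (_^_)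
  module S = CommutativeRing series
  open import Algebra.Properties.Semiring.Exp S.semiring as S-Exp using ()
    renaming (_^_ to _^ˢ_)
  open import Algebra.Properties.Semiring.Mult semiring using () renaming (_×_ to _·_)
  open import Algebra.Properties.Semiring.Mult S.semiring using () renaming (_×_ to _·ˢ_)

  ·-pointwise : ∀ n f k → (n ·ˢ f) k ≈ n · f k
  ·-pointwise zero    f k = refl
  ·-pointwise (suc n) f k = +-congˡ (·-pointwise n f k)

  ·-zero : ∀ n → n · 0# ≈ 0#
  ·-zero zero    = refl
  ·-zero (suc n) = trans (+-identityˡ _) (·-zero n)

  shift : Series → Series
  shift f zero    = 0#
  shift f (suc n) = f n

  shift-⊛ : ∀ f g → shift f ⊛ g ≋ shift (f ⊛ g)
  shift-⊛ f g zero    = zeroˡ _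
  shift-⊛ f g (suc n) = trans (+-congʳ (zeroˡ _)) (+-identityˡ _)

  shifts : ℕ → Series → Series
  shifts zero    f = f
  shifts (suc k) f = shift (shifts k f)

  shift-cong : ∀ {f g} → f ≋ g → shift f ≋ shift g
  shift-cong f≋g zero    = refl
  shift-cong f≋g (suc n) = f≋g n

  shifts-⊛ : ∀ k f g → f ⊛ shifts k g ≋ shifts k (f ⊛ g)
  shifts-⊛ zero    f g n = refl
  shifts-⊛ (suc k) f g n = begin
    (f ⊛ shift (shifts k g)) n  ≈⟨ ⊛-comm f _ n ⟩
    (shift (shifts k g) ⊛ f) n  ≈⟨ shift-⊛ (shifts k g) f n ⟩
    shift (shifts k g ⊛ f) n    ≈⟨ shift-cong (λ n → trans (⊛-comm (shifts k g) f n) (shifts-⊛ k f g n)) n ⟩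
    shift (shifts k (f ⊛ g)) n  ∎

  shift-^ : ∀ f k → shift f ^ˢ k ≋ shifts k (f ^ˢ k)
  shift-^ f zero    n = refl
  shift-^ f (suc k) n = trans (shift-⊛ f (shift f ^ˢ k) n)
    (shift-cong (λ n → trans (⊛-cong {f} (λ _ → refl) (shift-^ f k) n) (shifts-⊛ k f (f ^ˢ k) n)) n)

  shifts-+ : ∀ k f n → shifts k f (k ℕ.+ n) ≡ f n
  shifts-+ zero    f n = ≡.refl
  shifts-+ (suc k) f n = shifts-+ k f n

  shifts-< : ∀ k f n → n ℕ.< k → shifts k f n ≡ 0#
  shifts-< (suc k) f zero    _   = ≡.refl
  shifts-< (suc k) f (suc n) n<k = shifts-< k f n (ℕ.s<s⁻¹ n<k)

  constant-^ : ∀ x k → constant x ^ˢ k ≋ constant (x ^ k)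
  constant-^ x zero    n = refl
  constant-^ x (suc k) n = trans (constant-⊛ x (constant x ^ˢ k) n)
    (trans (*-congˡ (constant-^ x k n)) (scale-constant n))
    where
    scale-constant : ∀ n → x * constant (x ^ k) n ≈ constant (x ^ suc k) n
    scale-constant zero    = refl
    scale-constant (suc n) = zeroʳ x

  module _ {p} (prime[p] : Prime p) (p·1≈0 : p · 1# ≈ 0#) (fermat : ∀ x → x ^ p ≈ x) where

    p≢0 : ℕ.NonZero p
    p≢0 = prime⇒nonZero prime[p]

    -- With f = f₀ + X f⁺, additivity of the p-th power and f₀^p = f₀ give f^p = f₀ + X^p (f⁺)^p.
    -- Iterating this recursion replaces the infinite sum behind f^p = f(X^p).
    frobenius-expand : ∀ f → f ^ˢ p ≋ constant (f 0) ⊕ shifts p ((f ∘ suc) ^ˢ p)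
    frobenius-expand f n = begin
      (f ^ˢ p) n
        ≈⟨ S-Exp.^-congˡ p {f} {constant (f 0) ⊕ shift (f ∘ suc)} decompose n ⟩
      ((constant (f 0) ⊕ shift (f ∘ suc)) ^ˢ p) n
        ≈⟨ FreshmansDream.freshmans-dream series prime[p] p·1≈0ˢ (constant (f 0)) (shift (f ∘ suc)) n ⟩
      (constant (f 0) ^ˢ p) n + (shift (f ∘ suc) ^ˢ p) n
        ≈⟨ +-cong (trans (constant-^ (f 0) p n) (constant-cong (fermat (f 0)) n)) (shift-^ (f ∘ suc) p n) ⟩
      (constant (f 0) ⊕ shifts p ((f ∘ suc) ^ˢ p)) n ∎
      where
      decompose : f ≋ constant (f 0) ⊕ shift (f ∘ suc)
      decompose zero    = sym (+-identityʳ _)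
      decompose (suc n) = sym (+-identityˡ _)
      p·1≈0ˢ : p ·ˢ constant 1# ≋ λ _ → 0#
      p·1≈0ˢ zero    = trans (·-pointwise p (constant 1#) 0) p·1≈0
      p·1≈0ˢ (suc k) = trans (·-pointwise p (constant 1#) (suc k)) (·-zero p)
      constant-cong : ∀ {x y} → x ≈ y → constant x ≋ constant y
      constant-cong x≈y zero    = x≈y
      constant-cong x≈y (suc n) = refl

    constant-positive : ∀ x n → 0 ℕ.< n → constant x n ≡ 0#
    constant-positive x (suc n) _ = ≡.refl

    -- Together with `frobenius-∤` this is f^p = f(X^p), read coefficient by coefficient.
    frobenius-∣ : ∀ f n → (f ^ˢ p) (p ℕ.* n) ≈ f n
    frobenius-∣ f zero = begin
      (f ^ˢ p) (p ℕ.* 0)    ≡⟨ ≡.cong (f ^ˢ p) (ℕ.*-zeroʳ p) ⟩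
      (f ^ˢ p) 0            ≈⟨ frobenius-expand f 0 ⟩
      f 0 + shifts p _ 0    ≈⟨ +-congˡ (reflexive (shifts-< p _ 0 (ℕ.>-nonZero⁻¹ p {{p≢0}}))) ⟩
      f 0 + 0#              ≈⟨ +-identityʳ _ ⟩
      f 0                   ∎
    frobenius-∣ f (suc n) = begin
      (f ^ˢ p) (p ℕ.* suc n)
        ≡⟨ ≡.cong (f ^ˢ p) (ℕ.*-suc p n) ⟩
      (f ^ˢ p) (p ℕ.+ p ℕ.* n)
        ≈⟨ frobenius-expand f (p ℕ.+ p ℕ.* n) ⟩
      constant (f 0) (p ℕ.+ p ℕ.* n) + shifts p ((f ∘ suc) ^ˢ p) (p ℕ.+ p ℕ.* n)
        ≡⟨ ≡.cong₂ _+_ (constant-positive (f 0) _ (ℕ.≤-trans (ℕ.>-nonZero⁻¹ p {{p≢0}}) (ℕ.m≤m+n p _)))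
             (shifts-+ p ((f ∘ suc) ^ˢ p) (p ℕ.* n)) ⟩
      0# + ((f ∘ suc) ^ˢ p) (p ℕ.* n)
        ≈⟨ trans (+-identityˡ _) (frobenius-∣ (f ∘ suc) n) ⟩
      f (suc n) ∎

    -- The fuel b ≥ N makes the recursion N ↦ N − p structural.
    frobenius-∤ : ∀ b f N → N ℕ.≤ b → ¬ p ∣ N → (f ^ˢ p) N ≈ 0#
    frobenius-∤ b f zero _ p∤N = contradiction (p ∣0) p∤N
    frobenius-∤ (suc b) f N@(suc N-1) N≤b p∤N with N ℕ.<? p
    ... | yes N<p = trans (frobenius-expand f N)
      (trans (+-identityˡ _) (reflexive (shifts-< p ((f ∘ suc) ^ˢ p) N N<p)))
    ... | no  N≮p = begin
      (f ^ˢ p) N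
        ≈⟨ frobenius-expand f N ⟩
      0# + shifts p ((f ∘ suc) ^ˢ p) N
        ≈⟨ +-identityˡ _ ⟩
      shifts p ((f ∘ suc) ^ˢ p) N
        ≡⟨ ≡.cong (shifts p ((f ∘ suc) ^ˢ p)) (≡.sym p+N′≡N) ⟩
      shifts p ((f ∘ suc) ^ˢ p) (p ℕ.+ N′)
        ≡⟨ shifts-+ p ((f ∘ suc) ^ˢ p) N′ ⟩
      ((f ∘ suc) ^ˢ p) N′
        ≈⟨ frobenius-∤ b (f ∘ suc) N′ N′≤b (λ p∣N′ → p∤N (≡.subst (p ∣_) p+N′≡N (ℕ∣.∣m∣n⇒∣m+n ℕ∣.∣-refl p∣N′))) ⟩
      0# ∎
      where
      N′ = N ℕ.∸ p
      p+N′≡N : p ℕ.+ N′ ≡ N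
      p+N′≡N = ℕ.m+[n∸m]≡n (ℕ.≮⇒≥ N≮p)
      N′≤b : N′ ℕ.≤ b
      N′≤b = ℕ.s≤s⁻¹ (ℕ.≤-trans (ℕ.∸-monoʳ-< (ℕ.>-nonZero⁻¹ p {{p≢0}}) (ℕ.≮⇒≥ N≮p)) N≤b)

    ^-frobenius : ∀ f i → f ^ˢ (p ℕ.^ suc i) ≋ (f ^ˢ (p ℕ.^ i)) ^ˢ p
    ^-frobenius f i n = trans
      (S-Exp.^-congʳ f (ℕ.*-comm p (p ℕ.^ i)) n) (sym (S-Exp.^-assocʳ f (p ℕ.^ i) p n))

    frobenius^-∣ : ∀ f i n → (f ^ˢ (p ℕ.^ i)) (p ℕ.^ i ℕ.* n) ≈ f n
    frobenius^-∣ f zero n = begin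
      (f ^ˢ 1) (1 ℕ.* n)   ≈⟨ S.*-identityʳ f (1 ℕ.* n) ⟩
      f (1 ℕ.* n)          ≡⟨ ≡.cong f (ℕ.*-identityˡ n) ⟩
      f n                  ∎
    frobenius^-∣ f (suc i) n = begin
      (f ^ˢ (p ℕ.^ suc i)) (p ℕ.^ suc i ℕ.* n)        ≈⟨ ^-frobenius f i (p ℕ.^ suc i ℕ.* n) ⟩
      ((f ^ˢ (p ℕ.^ i)) ^ˢ p) (p ℕ.* p ℕ.^ i ℕ.* n)   ≡⟨ ≡.cong ((f ^ˢ (p ℕ.^ i)) ^ˢ p) (ℕ.*-assoc p (p ℕ.^ i) n) ⟩
      ((f ^ˢ (p ℕ.^ i)) ^ˢ p) (p ℕ.* (p ℕ.^ i ℕ.* n)) ≈⟨ frobenius-∣ (f ^ˢ (p ℕ.^ i)) (p ℕ.^ i ℕ.* n) ⟩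
      (f ^ˢ (p ℕ.^ i)) (p ℕ.^ i ℕ.* n)                ≈⟨ frobenius^-∣ f i n ⟩
      f n                                             ∎

    frobenius^-∤ : ∀ f i N → ¬ p ℕ.^ i ∣ N → (f ^ˢ (p ℕ.^ i)) N ≈ 0#
    frobenius^-∤ f zero    N ∤N = contradiction (divides N (≡.sym (ℕ.*-identityʳ N))) ∤N
    frobenius^-∤ f (suc i) N ∤N with p ∣? N
    ... | no  p∤N = trans (^-frobenius f i N) (frobenius-∤ N (f ^ˢ (p ℕ.^ i)) N ℕ.≤-refl p∤N)
    ... | yes (divides k ≡.refl) = begin
      (f ^ˢ (p ℕ.^ suc i)) (k ℕ.* p)       ≈⟨ ^-frobenius f i (k ℕ.* p) ⟩
      ((f ^ˢ (p ℕ.^ i)) ^ˢ p) (k ℕ.* p)    ≡⟨ ≡.cong ((f ^ˢ (p ℕ.^ i)) ^ˢ p) (ℕ.*-comm k p) ⟩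
      ((f ^ˢ (p ℕ.^ i)) ^ˢ p) (p ℕ.* k)    ≈⟨ frobenius-∣ (f ^ˢ (p ℕ.^ i)) k ⟩
      (f ^ˢ (p ℕ.^ i)) k                   ≈⟨ frobenius^-∤ f i k (λ pⁱ∣k →
        ∤N (≡.subst (p ℕ.* p ℕ.^ i ∣_) (ℕ.*-comm p k) (ℕ∣.*-monoʳ-∣ p pⁱ∣k))) ⟩
      0#                                   ∎

-- Integers modulo p

open import Data.Integer using (+_; -[1+_])

module ModularIntegers (p : ℕ) where

  infix 4 _≈_
  record _≈_ (x y : ℤ) : Set where
    constructor congruent
    field
      difference : + p ℤ∣ₛ.∣ x ℤ.- y

  open _≈_

  ≡⇒≈ : ∀ {x y} → x ≡ y → x ≈ y
  ≡⇒≈ {x} ≡.refl = congruent (ℤ∣ₛ.divides (+ 0) (ℤ.+-inverseʳ x))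

  ≈0⇒∣ : ∀ {x} → x ≈ + 0 → + p ℤ∣.∣ x
  ≈0⇒∣ {x} = ≡.subst (+ p ℤ∣.∣_) (ℤ.+-identityʳ x) ∘ ℤ∣ₛ.∣⇒∣ᵤ ∘ difference

  ∣⇒≈0 : ∀ {x} → + p ℤ∣.∣ x → x ≈ + 0
  ∣⇒≈0 {x} = congruent ∘ ℤ∣ₛ.∣ᵤ⇒∣ ∘ ≡.subst (+ p ℤ∣.∣_) (≡.sym (ℤ.+-identityʳ x))

  ≈-sym : ∀ {x y} → x ≈ y → y ≈ x
  ≈-sym {x} {y} x≈y = congruent (≡.subst (+ p ℤ∣ₛ.∣_) (lemma x y) (ℤ∣ₛ.∣m⇒∣-m (difference x≈y)))
    where
    lemma : ∀ x y → ℤ.- (x ℤ.- y) ≡ y ℤ.- x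
    lemma = ℤ-Solver.solve-∀

  ≈-trans : ∀ {x y z} → x ≈ y → y ≈ z → x ≈ z
  ≈-trans {x} {y} {z} x≈y y≈z = congruent (≡.subst (+ p ℤ∣ₛ.∣_) (lemma x y z) (ℤ∣ₛ.∣m∣n⇒∣m+n (difference x≈y) (difference y≈z)))
    where
    lemma : ∀ x y z → (x ℤ.- y) ℤ.+ (y ℤ.- z) ≡ x ℤ.- z
    lemma = ℤ-Solver.solve-∀

  +-cong : ∀ {x y u v} → x ≈ y → u ≈ v → x ℤ.+ u ≈ y ℤ.+ v
  +-cong {x} {y} {u} {v} x≈y u≈v = congruent (≡.subst (+ p ℤ∣ₛ.∣_) (lemma x y u v) (ℤ∣ₛ.∣m∣n⇒∣m+n (difference x≈y) (difference u≈v)))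
    where
    lemma : ∀ x y u v → (x ℤ.- y) ℤ.+ (u ℤ.- v) ≡ (x ℤ.+ u) ℤ.- (y ℤ.+ v)
    lemma = ℤ-Solver.solve-∀

  *-cong : ∀ {x y u v} → x ≈ y → u ≈ v → x ℤ.* u ≈ y ℤ.* v
  *-cong {x} {y} {u} {v} x≈y u≈v = congruent (≡.subst (+ p ℤ∣ₛ.∣_) (lemma x y u v)
    (ℤ∣ₛ.∣m∣n⇒∣m+n (ℤ∣ₛ.∣m⇒∣m*n u (difference x≈y)) (ℤ∣ₛ.∣n⇒∣m*n y (difference u≈v))))
    where
    lemma : ∀ x y u v → (x ℤ.- y) ℤ.* u ℤ.+ y ℤ.* (u ℤ.- v) ≡ x ℤ.* u ℤ.- y ℤ.* v
    lemma = ℤ-Solver.solve-∀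

  -‿cong : ∀ {x y} → x ≈ y → ℤ.- x ≈ ℤ.- y
  -‿cong {x} {y} x≈y = congruent (≡.subst (+ p ℤ∣ₛ.∣_) (lemma x y) (ℤ∣ₛ.∣m⇒∣-m (difference x≈y)))
    where
    lemma : ∀ x y → ℤ.- (x ℤ.- y) ≡ ℤ.- x ℤ.- ℤ.- y
    lemma = ℤ-Solver.solve-∀

  -- Integers with a coarser equality instead of a type of residues, so that the integer lifts in
  -- `AlgebraicModP` serve directly as coefficients.
  ℤ/p : CommutativeRing _ _
  ℤ/p = record
    { Carrier = ℤ ; _≈_ = _≈_ ; _+_ = ℤ._+_ ; _*_ = ℤ._*_ ; -_ = ℤ.-_ ; 0# = + 0 ; 1# = + 1
    ; isCommutativeRing = record
      { isRing = record
        { +-isAbelianGroup = record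
          { isGroup = record
            { isMonoid = record
              { isSemigroup = record
                { isMagma = record
                  { isEquivalence = record { refl = ≡⇒≈ ≡.refl ; sym = ≈-sym ; trans = ≈-trans }
                  ; ∙-cong = +-cong }
                ; assoc = λ x y z → ≡⇒≈ (ℤ.+-assoc x y z) }
              ; identity = ≡⇒≈ ∘ ℤ.+-identityˡ , ≡⇒≈ ∘ ℤ.+-identityʳ }
            ; inverse = ≡⇒≈ ∘ ℤ.+-inverseˡ , ≡⇒≈ ∘ ℤ.+-inverseʳ
            ; ⁻¹-cong = -‿cong }
          ; comm = λ x y → ≡⇒≈ (ℤ.+-comm x y) }
        ; *-cong = *-cong
        ; *-assoc = λ x y z → ≡⇒≈ (ℤ.*-assoc x y z)
        ; *-identity = ≡⇒≈ ∘ ℤ.*-identityˡ , ≡⇒≈ ∘ ℤ.*-identityʳ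
        ; distrib = (λ x y z → ≡⇒≈ (ℤ.*-distribˡ-+ x y z)) , (λ x y z → ≡⇒≈ (ℤ.*-distribʳ-+ x y z)) }
      ; *-comm = λ x y → ≡⇒≈ (ℤ.*-comm x y) } }

  _≈0? : ∀ x → Dec (x ≈ + 0)
  x ≈0? = map′ congruent difference (+ p ℤ∣ₛ.∣? (x ℤ.- + 0))

  module _ (prime[p] : Prime p) where

    1≉0 : ¬ + 1 ≈ + 0
    1≉0 1≈0 = prime∤1 prime[p] (≈0⇒∣ 1≈0)

    ℤ/p-domain : ∀ {x y} → ¬ x ≈ + 0 → ¬ y ≈ + 0 → ¬ x ℤ.* y ≈ + 0
    ℤ/p-domain {x} {y} x≉0 y≉0 xy≈0
      with euclidsLemma ℤ.∣ x ∣ ℤ.∣ y ∣ prime[p] (≡.subst (p ∣_) (ℤ.abs-* x y) (≈0⇒∣ xy≈0))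
    ... | inj₁ p∣x = x≉0 (∣⇒≈0 p∣x)
    ... | inj₂ p∣y = y≉0 (∣⇒≈0 p∣y)

    open CommutativeRing ℤ/p using (semiring; setoid)
    open import Algebra.Properties.Semiring.Exp semiring using (_^_)
    open import Algebra.Properties.Semiring.Mult semiring using () renaming (_×_ to _·_)
    open import Relation.Binary.Reasoning.Setoid setoid

    ·1≡ : ∀ n → n · + 1 ≡ + n
    ·1≡ zero    = ≡.refl
    ·1≡ (suc n) = ≡.cong (ℤ._+_ (+ 1)) (·1≡ n)

    p·1≈0 : p · + 1 ≈ + 0
    p·1≈0 = ∣⇒≈0 (≡.subst (+ p ℤ∣.∣_) (≡.sym (·1≡ p)) ℕ∣.∣-refl)

    1^≡1 : ∀ n → (+ 1) ^ n ≡ + 1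
    1^≡1 zero    = ≡.refl
    1^≡1 (suc n) = ≡.trans (ℤ.*-identityˡ ((+ 1) ^ n)) (1^≡1 n)

    0^≡0 : ∀ n → .{{ℕ.NonZero n}} → (+ 0) ^ n ≡ + 0
    0^≡0 (suc n) = ℤ.*-zeroˡ ((+ 0) ^ n)

    open FreshmansDream ℤ/p using (freshmans-dream)

    0^p≡0 : (+ 0) ^ p ≡ + 0
    0^p≡0 = 0^≡0 p {{prime⇒nonZero prime[p]}}

    fermat-ℕ : ∀ n → (+ n) ^ p ≈ + n
    fermat-ℕ zero    = ≡⇒≈ 0^p≡0
    fermat-ℕ (suc n) = begin
      (+ 1 ℤ.+ + n) ^ p       ≈⟨ freshmans-dream prime[p] p·1≈0 (+ 1) (+ n) ⟩
      (+ 1) ^ p ℤ.+ (+ n) ^ p     ≈⟨ +-cong (≡⇒≈ (1^≡1 p)) (fermat-ℕ n) ⟩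
      + 1 ℤ.+ + n             ∎

    -- Additivity of the p-th power applied to x + (-x) = 0; this avoids treating p = 2 apart from
    -- the odd primes.
    fermat-neg : ∀ x → x ^ p ≈ x → (ℤ.- x) ^ p ≈ ℤ.- x
    fermat-neg x xᵖ≈x = begin
      (ℤ.- x) ^ p                               ≡⟨ cancel x ((ℤ.- x) ^ p) ⟩
      ℤ.- x ℤ.+ (x ℤ.+ (ℤ.- x) ^ p)             ≈⟨ +-cong (≡⇒≈ {ℤ.- x} ≡.refl) (+-cong (≈-sym xᵖ≈x) (≡⇒≈ ≡.refl)) ⟩
      ℤ.- x ℤ.+ (x ^ p ℤ.+ (ℤ.- x) ^ p)         ≈⟨ +-cong (≡⇒≈ {ℤ.- x} ≡.refl) (freshmans-dream prime[p] p·1≈0 x (ℤ.- x)) ⟨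
      ℤ.- x ℤ.+ (x ℤ.- x) ^ p                   ≡⟨ ≡.cong (λ z → ℤ.- x ℤ.+ z ^ p) (ℤ.+-inverseʳ x) ⟩
      ℤ.- x ℤ.+ (+ 0) ^ p                         ≡⟨ ≡.cong (ℤ._+_ (ℤ.- x)) 0^p≡0 ⟩
      ℤ.- x ℤ.+ + 0                             ≡⟨ ℤ.+-identityʳ _ ⟩
      ℤ.- x                                     ∎
      where
      cancel : ∀ x y → y ≡ ℤ.- x ℤ.+ (x ℤ.+ y)
      cancel = ℤ-Solver.solve-∀

    fermat : ∀ x → x ^ p ≈ x
    fermat (+ n)    = fermat-ℕ n
    fermat -[1+ n ] = fermat-neg (+ suc n) (fermat-ℕ (suc n))

-- Transcendence modulo p

sumUpTo-suc : ∀ h n → sumUpTo h (suc n) ≡ h 0 ℤ.+ sumUpTo (h ∘ suc) n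
sumUpTo-suc h zero    = ≡.refl
sumUpTo-suc h (suc n) = ≡.trans (≡.cong (ℤ._+ h (suc (suc n))) (sumUpTo-suc h n)) (ℤ.+-assoc (h 0) _ _)

module Transcendence {p} (prime[p] : Prime p) where
  open ModularIntegers p
  open PowerSeries ℤ/p
  open CommutativeRing ℤ/p using (semiring; setoid; +-commutativeMonoid; refl; sym; trans; zeroˡ; zeroʳ; *-identityʳ; *-congˡ; *-congʳ; +-identityʳ; +-congˡ)
  open import Algebra.Properties.CommutativeMonoid.Sum +-commutativeMonoid
    using (sum; sum-cong-≋; sum-replicate-zero; sum-remove)
  open import Algebra.Properties.CommutativeMonoid.Sum S.+-commutativeMonoid
    using () renaming (sum to sumˢ)
  open import Algebra.Properties.Semiring.Exp S.semiring using () renaming (_^_ to _^ˢ_)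
  open import Relation.Binary.Reasoning.Setoid setoid

  polynomials : CoefficientRing series _
  polynomials = record
    { Q = FiniteSupport
    ; Q-1 = FiniteSupport-constant (+ 1)
    ; Q-0 = 0 , λ _ _ → refl
    ; Q-+ = λ {f} {g} → FiniteSupport-⊕ {f} {g}
    ; Q-* = λ {f} {g} → FiniteSupport-⊛ {f} {g}
    ; Q-neg = λ {f} → FiniteSupport-neg {f}
    ; _≈0? = λ {f} → FiniteSupport-≋0? _≈0? {f}
    ; 1≉0 = λ 1≋0 → 1≉0 prime[p] (1≋0 0)
    ; no-zero-divisors = λ {f} {g} → ⊛-domain _≈0? (ℤ/p-domain prime[p]) {f} {g} }

  open LinearDependence series polynomials using (evaluate; algebraic⇒powers-dependent)

  conv≡⊛ : ∀ f g n → conv f g n ≡ (f ⊛ g) n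
  conv≡⊛ f g zero    = ≡.refl
  conv≡⊛ f g (suc n) = ≡.trans (sumUpTo-suc (λ i → f i ℤ.* g (suc n ℕ.∸ i)) n)
    (≡.cong (ℤ._+_ (f 0 ℤ.* g (suc n))) (conv≡⊛ (f ∘ suc) g n))

  spow≋^ : ∀ f j → spow f j ≋ f ^ˢ j
  spow≋^ f zero    zero    = refl
  spow≋^ f zero    (suc n) = refl
  spow≋^ f (suc j) n = trans (≡⇒≈ (conv≡⊛ f (spow f j) n)) (⊛-cong {f} (λ _ → refl) (spow≋^ f j) n)

  evalFrom≋evaluate : ∀ f j P → evalFrom j P f ≋ evaluate f j (map coeffList P)
  evalFrom≋evaluate f j []      n = refl
  evalFrom≋evaluate f j (A ∷ P) n = +-cong
    (trans (≡⇒≈ (conv≡⊛ (coeffList A) (spow f j) n)) (⊛-cong {coeffList A} (λ _ → refl) (spow≋^ f j) n))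
    (evalFrom≋evaluate f (suc j) P n)

  coeffList-finite : ∀ A → FiniteSupport (coeffList A)
  coeffList-finite []      = 0 , λ _ _ → refl
  coeffList-finite (c ∷ A) = let D , A≈0 = coeffList-finite A in
    suc D , λ { (suc n) D<n → A≈0 n (ℕ.s≤s⁻¹ D<n) }

  coeffLists-finite : ∀ P → All FiniteSupport (map coeffList P)
  coeffLists-finite []      = []
  coeffLists-finite (A ∷ P) = coeffList-finite A ∷ coeffLists-finite P

  coeffList≉0 : ∀ {A} → Any (λ c → ¬ + p ℤ∣.∣ c) A → ¬ coeffList A ≋ λ _ → + 0
  coeffList≉0 (here p∤c)   A≋0 = p∤c (≈0⇒∣ (A≋0 0))
  coeffList≉0 (there p∤cs) A≋0 = coeffList≉0 p∤cs (A≋0 ∘ suc)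

  coeffLists≉0 : ∀ {P} → Any (Any (λ c → ¬ + p ℤ∣.∣ c)) P →
    Any (λ f → ¬ f ≋ λ _ → + 0) (map coeffList P)
  coeffLists≉0 (here A≉0)  = here (coeffList≉0 A≉0)
  coeffLists≉0 (there P≉0) = there (coeffLists≉0 P≉0)

  sumˢ-pointwise : ∀ {n} (t : Fin n → Series) k → sumˢ t k ≡ sum (λ i → t i k)
  sumˢ-pointwise {zero}  t k = ≡.refl
  sumˢ-pointwise {suc n} t k = ≡.cong (ℤ._+_ (t zero k)) (sumˢ-pointwise (t ∘ suc) k)

  sum-single : ∀ {n} (t : Fin n → ℤ) i → (∀ j → j ≢ i → t j ≈ + 0) → sum t ≈ t i
  sum-single {suc n} t i t≈0 = begin
    sum t                                    ≈⟨ sum-remove {i = i} t ⟩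
    t i ℤ.+ sum (λ j → t (Fin.punchIn i j))  ≈⟨ +-congˡ {t i} (trans (sum-cong-≋ λ j → t≈0 _ (Fin.punchInᵢ≢i i j)) (sum-replicate-zero n)) ⟩
    t i ℤ.+ + 0                              ≈⟨ +-identityʳ (t i) ⟩
    t i                                      ∎

  uniform-bound : ∀ {n} {c : Fin n → Series} → (∀ i → FiniteSupport (c i)) →
    ∃ λ D → ∀ i k → D ℕ.≤ k → c i k ≈ + 0
  uniform-bound {zero}  finite = 0 , λ ()
  uniform-bound {suc n} finite with finite zero | uniform-bound (finite ∘ suc)
  ... | D , c₀≈0 | E , c≈0 = D ℕ.⊔ E , λ
    { zero    k D⊔E≤k → c₀≈0 k (ℕ.≤-trans (ℕ.m≤m⊔n D E) D⊔E≤k)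
    ; (suc i) k D⊔E≤k → c≈0 i k (ℕ.≤-trans (ℕ.m≤n⊔m D E) D⊔E≤k) }

  module _ {m} (1≤m : 1 ℕ.≤ m) (f : Series)
    (f≡0 : ∀ {P} → Prime P → ∀ n → P ℕ.^ m ∣ n → f n ≡ + 0)
    (f≡1 : ∀ {n} → SquareFree n → f n ≡ + 1) where

    private
      instance
        _ : ℕ.NonZero p
        _ = prime⇒nonZero prime[p]

    frobenius-power : ℕ → Series
    frobenius-power i = f ^ˢ (p ℕ.^ i)

    -- Only exponents k = p^i v carry a coefficient, namely that of f at v, and P ^ m, being coprime
    -- to p^i, must divide v.
    frobenius-power≈0 : ∀ {P} → Prime P → ¬ P ∣ p → ∀ i k → P ℕ.^ m ∣ k → frobenius-power i k ≈ + 0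
    frobenius-power≈0 {P} prime[P] P∤p i k Pᵐ∣k with p ℕ.^ i ∣? k
    ... | no  pⁱ∤k = frobenius^-∤ prime[p] (p·1≈0 prime[p]) (fermat prime[p]) f i k pⁱ∤k
    ... | yes (divides v k≡vpⁱ) = begin
      frobenius-power i k               ≡⟨ ≡.cong (frobenius-power i) k≡pⁱv ⟩
      frobenius-power i (p ℕ.^ i ℕ.* v) ≈⟨ frobenius^-∣ prime[p] (p·1≈0 prime[p]) (fermat prime[p]) f i v ⟩
      f v                               ≡⟨ f≡0 prime[P] v (coprime-divisor Pᵐ⊥pⁱ (≡.subst (P ℕ.^ m ∣_) k≡pⁱv Pᵐ∣k)) ⟩
      + 0                               ∎
      where
      k≡pⁱv = ≡.trans k≡vpⁱ (ℕ.*-comm v (p ℕ.^ i))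
      Pᵐ⊥pⁱ : Coprime (P ℕ.^ m) (p ℕ.^ i)
      Pᵐ⊥pⁱ = coprime-^ i (Coprimality.sym (coprime-^ m (∤⇒coprime prime[P] P∤p)))

    module _ {n} {c : Fin n → Series} (finite : ∀ i → FiniteSupport (c i))
      (relation : sumˢ (λ i → c i ⊛ frobenius-power (toℕ i)) ≋ λ _ → + 0) where

      -- The relation is read at N = j₀ + p^s u. In the product with c_i, the index j meets the
      -- exponent N - j, and every such exponent with j ≤ D is killed except p^s u at j = j₀. That
      -- one contributes nothing for i > s, since p does not divide u, while i < s is excluded by
      -- assumption; what remains is c_s at j₀ times f(u) = 1.
      coefficient≈0 : ∀ s → (∀ i → toℕ i ℕ.< toℕ s → c i ≋ λ _ → + 0) → c s ≋ λ _ → + 0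
      coefficient≈0 s lower≈0 j₀ with uniform-bound finite
      ... | D , c≈0 with D ℕ.≤? j₀
      ...   | yes D≤j₀ = c≈0 s j₀ D≤j₀
      ...   | no  D≰j₀
        -- The window is read backwards: position D - j stands for the exponent N - j, so the
        -- survivor sits at D - j₀. The class 1 modulo p keeps u prime to p.
        with Isolation.isolate m 1≤m (p ℕ.^ toℕ s) p 1 D (D ℕ.∸ j₀) {{ℕ.m^n≢0 p (toℕ s)}}
               (Coprimality.1-coprimeTo p) (ℕ.m∸n≤m D j₀)
      ...     | t , x , _ , position , squareFree , killed = begin
        c s j₀                                                       ≈⟨ *-identityʳ (c s j₀) ⟨
        c s j₀ ℤ.* + 1                                               ≡⟨ ≡.cong (ℤ._*_ (c s j₀)) (≡.sym (f≡1 squareFree)) ⟩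
        c s j₀ ℤ.* f u                                               ≈⟨ *-congˡ {c s j₀} (frobenius^-∣ prime[p] (p·1≈0 prime[p]) (fermat prime[p]) f (toℕ s) u) ⟨
        c s j₀ ℤ.* frobenius-power (toℕ s) (K ℕ.* u)                 ≈⟨ ⊛-single (c s) (frobenius-power (toℕ s)) j₀ (K ℕ.* u) others≈0 ⟨
        (c s ⊛ frobenius-power (toℕ s)) N                            ≈⟨ sum-single (λ i → (c i ⊛ frobenius-power (toℕ i)) N) s terms≈0 ⟨
        sum (λ i → (c i ⊛ frobenius-power (toℕ i)) N)                ≡⟨ sumˢ-pointwise (λ i → c i ⊛ frobenius-power (toℕ i)) N ⟨
        sumˢ (λ i → c i ⊛ frobenius-power (toℕ i)) N                 ≈⟨ relation N ⟩
        + 0                                                          ∎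
        where
        j₀≤D : j₀ ℕ.≤ D
        j₀≤D = ℕ.≰⇒≥ D≰j₀
        K = p ℕ.^ toℕ s
        instance
          K≢0 : ℕ.NonZero K
          K≢0 = ℕ.m^n≢0 p (toℕ s)
        u = 1 ℕ.+ p ℕ.* t
        N = j₀ ℕ.+ K ℕ.* u

        p∤u : ¬ p ∣ u
        p∤u p∣u = prime∤1 prime[p] (ℕ∣.∣m+n∣m⇒∣n (≡.subst (p ∣_) (ℕ.+-comm 1 (p ℕ.* t)) p∣u) (ℕ∣.m∣m*n t))

        N≡x+D : N ≡ x ℕ.+ D
        N≡x+D = ≡.trans (≡.cong (j₀ ℕ.+_) (≡.sym position))
          (≡.trans (ℕ+.x∙yz≈y∙xz j₀ x (D ℕ.∸ j₀)) (≡.cong (x ℕ.+_) (ℕ.m+[n∸m]≡n j₀≤D)))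

        off-position≈0 : ∀ i j k → j ℕ.+ k ≡ N → j ≢ j₀ → c i j ℤ.* frobenius-power (toℕ i) k ≈ + 0
        off-position≈0 i j k j+k≡N j≢j₀ with D ℕ.≤? j
        ... | yes D≤j = trans (*-congʳ (c≈0 i j D≤j)) (zeroˡ (frobenius-power (toℕ i) k))
        ... | no  D≰j =
          let P , prime[P] , P∤p , Pᵐ∣ = killed (D ℕ.∸ j) (ℕ.m∸n≤m D j) D∸j≢D∸j₀
          in trans (*-congˡ {c i j} (frobenius-power≈0 prime[P] P∤p (toℕ i) k (≡.subst (P ℕ.^ m ∣_) x+D∸j≡k Pᵐ∣)))
               (zeroʳ (c i j))
          where
          j≤D = ℕ.≰⇒≥ D≰j
          D∸j≢D∸j₀ : D ℕ.∸ j ≢ D ℕ.∸ j₀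
          D∸j≢D∸j₀ eq = j≢j₀ (ℕ.∸-cancelˡ-≡ j≤D j₀≤D eq)
          x+D∸j≡k : x ℕ.+ (D ℕ.∸ j) ≡ k
          x+D∸j≡k = ≡.trans (≡.sym (ℕ.+-∸-assoc x j≤D))
            (≡.trans (≡.cong (ℕ._∸ j) (≡.sym (≡.trans j+k≡N N≡x+D))) (ℕ.m+n∸m≡n j k))

        others≈0 : ∀ j k → j ℕ.+ k ≡ N → j ≢ j₀ → c s j ℤ.* frobenius-power (toℕ s) k ≈ + 0
        others≈0 = off-position≈0 s

        terms≈0 : ∀ i → i ≢ s → (c i ⊛ frobenius-power (toℕ i)) N ≈ + 0
        terms≈0 i i≢s with ℕ.<-cmp (toℕ i) (toℕ s)
        ... | tri< i<s _ _ = ⊛-vanishes (c i) _ N λ j k _ → trans (*-congʳ (lower≈0 i i<s j)) (zeroˡ (frobenius-power (toℕ i) k))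
        ... | tri≈ _ i≡s _ = contradiction (Fin.toℕ-injective i≡s) i≢s
        ... | tri> _ _ s<i = ⊛-vanishes (c i) _ N on-position≈0
          where
          pⁱ∤Ku : ¬ p ℕ.^ toℕ i ∣ K ℕ.* u
          pⁱ∤Ku pⁱ∣Ku = p∤u (ℕ∣.*-cancelˡ-∣ K (ℕ∣.∣-trans
            (≡.subst (_∣ p ℕ.^ toℕ i) (ℕ.*-comm p K) (^-mono-∣ s<i)) pⁱ∣Ku))
            where
            ^-mono-∣ : ∀ {a b} → a ℕ.≤ b → p ℕ.^ a ∣ p ℕ.^ b
            ^-mono-∣ {a} {b} a≤b = ≡.subst (λ e → p ℕ.^ a ∣ p ℕ.^ e) (ℕ.m+[n∸m]≡n a≤b)
              (≡.subst (p ℕ.^ a ∣_) (≡.sym (ℕ.^-distribˡ-+-* p a (b ℕ.∸ a))) (ℕ∣.m∣m*n _))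
          on-position≈0 : ∀ j k → j ℕ.+ k ≡ N → c i j ℤ.* frobenius-power (toℕ i) k ≈ + 0
          on-position≈0 j k j+k≡N with j ℕ.≟ j₀
          ... | no  j≢j₀   = off-position≈0 i j k j+k≡N j≢j₀
          ... | yes ≡.refl = trans (*-congˡ {c i j} (frobenius^-∤ prime[p] (p·1≈0 prime[p]) (fermat prime[p]) f (toℕ i) k
            (≡.subst (λ y → ¬ p ℕ.^ toℕ i ∣ y) (≡.sym (ℕ.+-cancelˡ-≡ j k (K ℕ.* u) j+k≡N)) pⁱ∤Ku))) (zeroʳ (c i j))

      coefficients≈0 : ∀ b i → toℕ i ℕ.< b → c i ≋ λ _ → + 0
      coefficients≈0 (suc b) i i<1+b = coefficient≈0 i λ j j<i →
        coefficients≈0 b j (ℕ.<-≤-trans j<i (ℕ.s≤s⁻¹ i<1+b))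

    transcendental : ¬ AlgebraicModP p f
    transcendental (P , P≉0 , root) =
      let n , c , finite , (i , cᵢ≉0) , relation = algebraic⇒powers-dependent f {map coeffList P} (coeffLists-finite P) (coeffLists≉0 P≉0)
            (λ k → trans (sym (evalFrom≋evaluate f 0 P k)) (∣⇒≈0 (root k))) (p ℕ.^_)
      in cᵢ≉0 (coefficients≈0 finite relation (suc (toℕ i)) i ℕ.≤-refl)

-- The series of `q`, modulo primes and over the integers

qSeries≡0 : ∀ {m P} → 1 ℕ.≤ m → Prime P → ∀ n → P ℕ.^ m ∣ n → qSeries m n ≡ + 0
qSeries≡0 1≤m prime[P] zero    _    = ≡.refl
qSeries≡0 1≤m prime[P] (suc n) Pᵐ∣n = ≡.cong +_ (q≡0 1≤m prime[P] (s≤s z≤n) Pᵐ∣n)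

qSeries≡1 : ∀ {m n} → 2 ℕ.≤ m → SquareFree n → qSeries m n ≡ + 1
qSeries≡1 {n = zero}  2≤m sf = contradiction (4 ∣0) (sf 2 ℕ.≤-refl)
qSeries≡1 {n = suc n} 2≤m sf = ≡.cong +_ (q≡1 2≤m sf)

¬algebraicModP : ∀ {m p} → 2 ℕ.≤ m → Prime p → ¬ AlgebraicModP p (qSeries m)
¬algebraicModP {m} 2≤m prime[p] = Transcendence.transcendental prime[p] 1≤m (qSeries m) (qSeries≡0 1≤m) (qSeries≡1 2≤m)
  where
  1≤m = ℕ.<⇒≤ 2≤m

-- A prime exceeding the absolute value of one nonzero coefficient cannot divide it, so the
-- polynomial stays nonzero after reduction.
nonzero-mod-prime : ∀ {P : List (List ℤ)} → Any (Any (λ c → c ≢ + 0)) P →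
  ∃ λ p → Prime p × Any (Any (λ c → ¬ + p ℤ∣.∣ c)) P
nonzero-mod-prime (there P≢0) = let p , prime[p] , P≉0 = nonzero-mod-prime P≢0 in p , prime[p] , there P≉0
nonzero-mod-prime (here A≢0)  = let p , prime[p] , A≉0 = in-list A≢0 in p , prime[p] , here A≉0
  where
  in-list : ∀ {A} → Any (λ c → c ≢ + 0) A → ∃ λ p → Prime p × Any (λ c → ¬ + p ℤ∣.∣ c) A
  in-list (there A≢0) = let p , prime[p] , A≉0 = in-list A≢0 in p , prime[p] , there A≉0
  in-list {c ∷ _} (here c≢0) = let p , prime[p] , c<p = prime> ℤ.∣ c ∣ in
    p , prime[p] , here λ p∣c → ℕ.<⇒≱ c<p (ℕ∣.∣⇒≤ {{ℕ.≢-nonZero (c≢0 ∘ ℤ.∣i∣≡0⇒i≡0)}} p∣c)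

theorem2p15 : ∀ (m : ℕ) → 2 ≤ m →
    (∀ (k : ℕ) → 2 ≤ k → ¬ Automatic k (q m))
    × (∀ (p : ℕ) → Prime p → ¬ AlgebraicModP p (qSeries m))
    × ¬ AlgebraicZ (qSeries m)
theorem2p15 m 2≤m =
  (λ k → ¬automatic 2≤m) ,
  (λ p → ¬algebraicModP 2≤m) ,
  -- The prime is chosen after the relation, which is possible because the modular result holds at
  -- every prime.
  λ (P , P≢0 , root) →
    let p , prime[p] , P≉0 = nonzero-mod-prime P≢0
    in ¬algebraicModP 2≤m prime[p] (P , P≉0 , λ n → ≡.subst (+ p ℤ∣.∣_) (≡.sym (root n)) (p ∣0))
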